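{- Let $n\ge 1$, let $\lambda$ be a partition of $n$, identified with its Young diagram, and let $P$ be any standard Young tableau of shape $\lambda$. Let $$\pi_\lambda(x)=\sum_{Q\in\mathfrak{st}_\lambda}x^{|q_{P,Q}|},$$ where $\mathfrak{st}_\lambda$ is the set of standard Young tableaux of shape $\lambda$, $q_{P,Q}$ is the $P$-pedestal of $Q$ and $|q_{P,Q}|=\sum_{\alpha\in\lambda}q_{P,Q}(\alpha)$. (Thus $\pi_\lambda(x)$ is the principal specialization $x_i\mapsto x^i$ of the polynomial $\sum_{Q\in\mathfrak{st}_\lambda}\prod_{\alpha\in\lambda}x_{q_{P,Q}(\alpha)}$.) Then, as formal power series in $x$, $$\frac{1}{\prod_{\alpha\in\lambda}(1-x^{h_\alpha})}=\frac{\pi_\lambda(x)}{(1-x)(1-x^2)\cdots(1-x^n)},$$ where $h_\alpha$ is the hook length of the node $\alpha$ of $\lambda$.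
   Context: A partition $\lambda=(\lambda_1\ge\dots\ge\lambda_l>0)$ of $n$ is identified with the set of nodes $(i,j)$ with $1\le i\le l$, $1\le j\le\lambda_i$. The hook length $h_\alpha$ of a node $\alpha=(i,j)\in\lambda$ is the number of nodes $(i',j')\in\lambda$ with either $i'=i,\ j'\ge j$ or $j'=j,\ i'>i$. A standard Young tableau of shape $\lambda$ is a bijection $Q\colon\lambda\to\{1,\dots,n\}$ such that $Q(i,j)$ increases in $i$ and in $j$; the set of these is $\mathfrak{st}_\lambda$. For $Q\in\mathfrak{st}_\lambda$, the linear order $\preccurlyeq_Q$ on the nodes is given by $\alpha\prec_Q\beta$ iff $Q(\alpha)<Q(\beta)$. Given $P,Q\in\mathfrak{st}_\lambda$, let $\alpha_1\prec_Q\alpha_2\prec_Q\dots\prec_Q\alpha_n$ be the list of all nodes of $\lambda$ enumerated according to $\preccurlyeq_Q$. A node $\alpha_k$ (with $1\le k<n$) is called a $(P,Q)$-disagreement node if $\alpha_{k+1}\prec_P\alpha_k$. The $P$-pedestal of $Q$ is the function $q_{P,Q}\colon\lambda\to\mathbb{Z}_{\ge 0}$ defined by $$q_{P,Q}(\alpha_k)=\#\{\,l : l<k,\ \alpha_l\text{ is a }(P,Q)\text{ -disagreement node}\,\}.$$ -}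

module Defs where

open import Data.Fin.Base as Fin using (Fin; toℕ; zero; suc)
import Data.Fin.Properties as Fin
open import Data.Integer.Base as ℤ using (ℤ; 0ℤ; 1ℤ)
import Data.Integer.Properties as ℤ
open import Data.List.Base
  using (List; []; _∷_; map; foldr; filter; length; allFin; upTo;
         concatMap; cartesianProductWith; lookup)
open import Data.List.Membership.Propositional using (_∈_)
open import Data.List.Membership.Propositional.Properties
  using (∈-map⁺; ∈-concatMap⁺; ∈-allFin; ∈-filter⁺; ∈-length)
open import Data.List.Relation.Unary.All as All using (All; []; _∷_)
import Data.List.Relation.Unary.All.Properties as All
open import Data.List.Relation.Unary.AllPairs as AllPairs using (AllPairs; []; _∷_)
import Data.List.Relation.Unary.AllPairs.Properties as AllPairs
open import Data.List.Relation.Unary.Any as Any using (Any; here; there)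
import Data.List.Relation.Unary.Any.Properties as Any
open import Data.List.Relation.Unary.Linked using (Linked)
open import Data.List.Relation.Unary.Unique.Setoid using (Unique)
import Data.List.Relation.Unary.Unique.Setoid.Properties as Unique
import Data.List.Relation.Unary.Unique.Propositional.Properties as Uniqueₚ
open import Data.Nat.Base as ℕ using (ℕ; zero; suc; _∸_)
open import Data.Nat.ListAction using (sum)
import Data.Nat.Properties as ℕ
open import Data.Product.Base using (Σ; Σ-syntax; ∃-syntax; _×_; _,_; proj₁; proj₂; uncurry)
open import Data.Product.Properties using (≡-dec)
open import Data.Sum.Base using (_⊎_; inj₁; inj₂)
open import Data.Vec.Base as Vec using (Vec; []; _∷_)
open import Level using (0ℓ)
open import Function.Base using (_∘_)
open import Function.Consequences.Propositional using (strictlySurjective⇒surjective; surjective⇒strictlySurjective)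
open import Function.Definitions using (Injective; Surjective; Bijective)
open import Relation.Binary.Bundles using (Setoid)
open import Relation.Binary.PropositionalEquality
  using (_≡_; _≗_; refl; sym; trans; cong; cong₂; setoid; subst₂; module ≡-Reasoning)
open import Relation.Nullary using (Dec; yes; no; ¬_; contradiction)
open import Relation.Nullary.Decidable using (map′; _×-dec_; _⊎-dec_; _→-dec_)
open import Relation.Unary using (Pred; Decidable)
open import Algebra.Properties.Semiring.Sum ℤ.+-*-semiring using (sum-syntax; sum-cong-≋)

PowerSeries : Set
PowerSeries = ℕ → ℤ

infixl 6 _⊕_ _⊖_
infixl 7 _⊛_
infix  8 x^_ _⁻¹

x^_ : ℕ → PowerSeries
(x^ zero)  zero    = 1ℤ
(x^ zero)  (suc n) = 0ℤ
(x^ suc k) zero    = 0ℤ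
(x^ suc k) (suc n) = (x^ k) n

𝟘 𝟙 : PowerSeries
𝟘 _ = 0ℤ
𝟙 = x^ 0

_⊕_ _⊖_ _⊛_ : PowerSeries → PowerSeries → PowerSeries
(f ⊕ g) n = f n ℤ.+ g n
(f ⊖ g) n = f n ℤ.- g n
(f ⊛ g) n = ∑[ k < suc n ] (f (toℕ k) ℤ.* g (n ∸ toℕ k))

-- The first coefficients of 1/f, in the order bₙ , … , b₁ , b₀, from
-- b₀ = 1 and bₙ₊₁ = - ∑ₖ fₖ₊₁ bₙ₋ₖ.
inverseCoefficients : PowerSeries → (n : ℕ) → Vec ℤ (suc n)
inverseCoefficients f zero    = 1ℤ ∷ []
inverseCoefficients f (suc n) =
  ℤ.- (∑[ k < suc n ] (f (suc (toℕ k)) ℤ.* Vec.lookup bs k)) ∷ bs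
  where bs = inverseCoefficients f n

-- Only meaningful for series with constant term 1; see ⁻¹-inverseʳ.
_⁻¹ : PowerSeries → PowerSeries
(f ⁻¹) n = Vec.head (inverseCoefficients f n)

⨁ ∏ : List PowerSeries → PowerSeries
⨁ = foldr _⊕_ 𝟘
∏ = foldr _⊛_ 𝟙

lookup-inverseCoefficients : ∀ f n (k : Fin (suc n)) →
  Vec.lookup (inverseCoefficients f n) k ≡ (f ⁻¹) (n ∸ toℕ k)
lookup-inverseCoefficients f zero    zero    = refl
lookup-inverseCoefficients f (suc n) zero    = refl
lookup-inverseCoefficients f (suc n) (suc k) = lookup-inverseCoefficients f n k

⁻¹-inverseʳ : ∀ f → f 0 ≡ 1ℤ → f ⊛ f ⁻¹ ≗ 𝟙
⁻¹-inverseʳ f f₀≡1 zero rewrite f₀≡1 = refl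
⁻¹-inverseʳ f f₀≡1 (suc n) = begin
  f 0 ℤ.* ℤ.- s ℤ.+ t  ≡⟨ cong (λ c → c ℤ.* ℤ.- s ℤ.+ t) f₀≡1 ⟩
  1ℤ ℤ.* ℤ.- s ℤ.+ t   ≡⟨ cong (ℤ._+ t) (ℤ.*-identityˡ (ℤ.- s)) ⟩
  ℤ.- s ℤ.+ t          ≡⟨ cong (λ c → ℤ.- c ℤ.+ t) s≡t ⟩
  ℤ.- t ℤ.+ t          ≡⟨ ℤ.+-inverseˡ t ⟩
  0ℤ                   ∎
  where
  open ≡-Reasoning
  s t : ℤ
  s = ∑[ k < suc n ] (f (suc (toℕ k)) ℤ.* Vec.lookup (inverseCoefficients f n) k)
  t = ∑[ k < suc n ] (f (suc (toℕ k)) ℤ.* (f ⁻¹) (n ∸ toℕ k))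
  s≡t : s ≡ t
  s≡t = sum-cong-≋ {suc n} λ k →
    cong (f (suc (toℕ k)) ℤ.*_) (lookup-inverseCoefficients f n k)

∏-constant : ∀ {fs} → All (λ f → f 0 ≡ 1ℤ) fs → ∏ fs 0 ≡ 1ℤ
∏-constant []       = refl
∏-constant (p ∷ ps) rewrite p | ∏-constant ps = refl

record Partition (n : ℕ) : Set where
  field
    parts      : List ℕ
    decreasing : Linked ℕ._≥_ parts
    positive   : All (1 ℕ.≤_) parts
    total      : sum parts ≡ n

open Partition public

-- Rows and columns are numbered from 0.
Node : ∀ {n} → Partition n → Set
Node μ = Σ[ i ∈ Fin (length (parts μ)) ] Fin (lookup (parts μ) i)

nodes : ∀ {n} (μ : Partition n) → List (Node μ)
nodes μ = concatMap (λ i → map (i ,_) (allFin (lookup (parts μ) i)))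
                    (allFin (length (parts μ)))

nodes-complete : ∀ {n} (μ : Partition n) (α : Node μ) → α ∈ nodes μ
nodes-complete μ (i , j) = ∈-concatMap⁺ _ (Any.map (λ { refl → ∈-map⁺ (i ,_) (∈-allFin j) }) (∈-allFin i))

module _ {n} (μ : Partition n) where

  count : {P : Pred (Node μ) 0ℓ} → Decidable P → ℕ
  count P? = length (filter P? (nodes μ))

  all-nodes? : {P : Pred (Node μ) 0ℓ} → Decidable P → Dec (∀ α → P α)
  all-nodes? P? =
    map′ uncurry (λ f i j → f (i , j)) (Fin.all? λ i → Fin.all? λ j → P? (i , j))

  any-node? : {P : Pred (Node μ) 0ℓ} → Decidable P → Dec (∃[ α ] P α)
  any-node? P? = map′ (λ { (i , j , p) → (i , j) , p }) (λ { ((i , j) , p) → i , j , p })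
    (Fin.any? λ i → Fin.any? λ j → P? (i , j))

  InHook : Node μ → Node μ → Set
  InHook (i , j) (i′ , j′) =
    (toℕ i′ ≡ toℕ i × toℕ j′ ℕ.≥ toℕ j) ⊎ (toℕ j′ ≡ toℕ j × toℕ i′ ℕ.> toℕ i)

  inHook? : ∀ α → Decidable (InHook α)
  inHook? (i , j) (i′ , j′) =
    ((toℕ i′ ℕ.≟ toℕ i) ×-dec (toℕ j ℕ.≤? toℕ j′)) ⊎-dec
    ((toℕ j′ ℕ.≟ toℕ j) ×-dec (toℕ i ℕ.<? toℕ i′))

  hookLength : Node μ → ℕ
  hookLength α = count (inHook? α)

  hookLength-positive : ∀ α → 1 ℕ.≤ hookLength α
  hookLength-positive α =
    ∈-length (∈-filter⁺ (inHook? α) (nodes-complete μ α) (inj₁ (refl , ℕ.≤-refl)))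

-- The entries 1, …, n are represented by Fin n.
Filling : ∀ {n} → Partition n → Set
Filling {n} μ = Node μ → Fin n

module _ {n} (μ : Partition n) where

  RowIncreasing ColumnIncreasing IsStandard : Filling μ → Set
  RowIncreasing    Q = ∀ i j j′ → j Fin.< j′ → Q (i , j) Fin.< Q (i , j′)
  ColumnIncreasing Q = ∀ i i′ j j′ → i Fin.< i′ → toℕ j ≡ toℕ j′ →
                       Q (i , j) Fin.< Q (i′ , j′)
  IsStandard       Q = Bijective _≡_ _≡_ Q × RowIncreasing Q × ColumnIncreasing Q

  isStandard? : Decidable IsStandard
  isStandard? Q = (injective? ×-dec surjective?) ×-dec
    (Fin.all? λ i → Fin.all? λ j → Fin.all? λ j′ →
      (j Fin.<? j′) →-dec (Q (i , j) Fin.<? Q (i , j′))) ×-dec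
    (Fin.all? λ i → Fin.all? λ i′ → Fin.all? λ j → Fin.all? λ j′ →
      (i Fin.<? i′) →-dec ((toℕ j ℕ.≟ toℕ j′) →-dec (Q (i , j) Fin.<? Q (i′ , j′))))
    where
    injective? : Dec (Injective _≡_ _≡_ Q)
    injective? = map′ (λ f {α} {β} → f α β) (λ f α β → f)
      (all-nodes? μ λ α → all-nodes? μ λ β → (Q α Fin.≟ Q β) →-dec ≡-dec Fin._≟_ Fin._≟_ α β)

    surjective? : Dec (Surjective _≡_ _≡_ Q)
    surjective? = map′ strictlySurjective⇒surjective surjective⇒strictlySurjective
      (Fin.all? λ k → any-node? μ λ α → Q α Fin.≟ k)

  IsStandard-resp-≗ : {Q R : Filling μ} → Q ≗ R → IsStandard Q → IsStandard R
  IsStandard-resp-≗ Q≗R ((inj , surj) , row , col) =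
    ( (λ {α} {β} e → inj (trans (Q≗R α) (trans e (sym (Q≗R β)))))
    , λ k → let α , p = surj k in α , λ e → trans (sym (Q≗R _)) (p e) ) ,
    (λ i j j′ lt → subst₂ Fin._<_ (Q≗R _) (Q≗R _) (row i j j′ lt)) ,
    (λ i i′ j j′ lt e → subst₂ Fin._<_ (Q≗R _) (Q≗R _) (col i i′ j j′ lt e))

Πsetoid : ∀ {m} → (Fin m → Setoid 0ℓ 0ℓ) → Setoid 0ℓ 0ℓ
Πsetoid {m} S = record
  { Carrier       = ∀ i → S.Carrier i
  ; _≈_           = λ f g → ∀ i → S._≈_ i (f i) (g i)
  ; isEquivalence = record
    { refl  = λ i → S.refl i
    ; sym   = λ p i → S.sym i (p i)
    ; trans = λ p q i → S.trans i (p i) (q i)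
    }
  }
  where module S i = Setoid (S i)

cons : ∀ {m} {B : Fin (suc m) → Set} → B zero → (∀ i → B (suc i)) → ∀ i → B i
cons b f zero    = b
cons b f (suc i) = f i

choices : ∀ {m} {B : Fin m → Set} → (∀ i → List (B i)) → List (∀ i → B i)
choices {zero}  xs = (λ ()) ∷ []
choices {suc m} xs = cartesianProductWith cons (xs zero) (choices (xs ∘ suc))

choices-complete : ∀ {m} {B : Fin m → Set} {xs : ∀ i → List (B i)} {P : ∀ i → Pred (B i) 0ℓ} →
  (∀ i → Any (P i) (xs i)) → Any (λ f → ∀ i → P i (f i)) (choices xs)
choices-complete {zero}  p = here λ ()
choices-complete {suc m} p = Any.cartesianProductWith⁺ cons
  (λ { q r zero → q ; q r (suc i) → r i }) (p zero) (choices-complete (p ∘ suc))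

choices-unique : ∀ {m} (S : Fin m → Setoid 0ℓ 0ℓ) {xs : ∀ i → List (Setoid.Carrier (S i))} →
  (∀ i → Unique (S i) (xs i)) → Unique (Πsetoid S) (choices xs)
choices-unique {zero}  S p = [] ∷ []
choices-unique {suc m} S p = Unique.cartesianProductWith⁺
  (S zero) (Πsetoid (S ∘ suc)) (Πsetoid S) cons
  (λ e → e zero , e ∘ suc) (p zero) (choices-unique (S ∘ suc) (p ∘ suc))

fillings : ∀ {n} (μ : Partition n) → List (Filling μ)
fillings {n} μ = map uncurry (choices λ i → choices λ j → allFin n)

-- 𝔰𝔱 μ lists every standard tableau exactly once, up to pointwise equality;
-- see 𝔰𝔱-standard, 𝔰𝔱-complete and 𝔰𝔱-unique.
𝔰𝔱 : ∀ {n} (μ : Partition n) → List (Filling μ)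
𝔰𝔱 μ = filter (isStandard? μ) (fillings μ)

𝔰𝔱-standard : ∀ {n} (μ : Partition n) → All (IsStandard μ) (𝔰𝔱 μ)
𝔰𝔱-standard μ = All.all-filter (isStandard? μ) (fillings μ)

fillings-complete : ∀ {n} (μ : Partition n) (Q : Filling μ) → Any (Q ≗_) (fillings μ)
fillings-complete μ Q = Any.map⁺ (Any.map uncurry
  (choices-complete λ i → choices-complete λ j → ∈-allFin (Q (i , j))))

any-filter : ∀ {A : Set} {P Q : Pred A 0ℓ} (Q? : Decidable Q) → (∀ {x} → P x → Q x) →
  ∀ {xs} → Any P xs → Any P (filter Q? xs)
any-filter Q? P⇒Q {x ∷ _} (here px) with Q? x
... | yes _  = here px
... | no ¬qx = contradiction (P⇒Q px) ¬qx
any-filter Q? P⇒Q {x ∷ _} (there pxs) with Q? x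
... | yes _ = there (any-filter Q? P⇒Q pxs)
... | no  _ = any-filter Q? P⇒Q pxs

𝔰𝔱-complete : ∀ {n} (μ : Partition n) (Q : Filling μ) → IsStandard μ Q → Any (Q ≗_) (𝔰𝔱 μ)
𝔰𝔱-complete μ Q std = any-filter (isStandard? μ)
  (λ Q≗R → IsStandard-resp-≗ μ Q≗R std) (fillings-complete μ Q)

𝔰𝔱-unique : ∀ {n} (μ : Partition n) → AllPairs (λ Q R → ¬ (Q ≗ R)) (𝔰𝔱 μ)
𝔰𝔱-unique {n} μ = AllPairs.filter⁺ (isStandard? μ) (AllPairs.map⁺
  (AllPairs.map (λ ne e → ne λ i j → e (i , j))
    (choices-unique (λ i → Πsetoid λ j → setoid (Fin n)) λ i →
      choices-unique (λ j → setoid (Fin n)) λ j → Uniqueₚ.allFin⁺ n)))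

module _ {n} (μ : Partition n) (P Q : Filling μ) where

  -- If α = αₖ in the enumeration α₁ ≺_Q … ≺_Q αₙ, then β with
  -- Q β = Q α + 1 is αₖ₊₁; there is none when k = n.
  Disagreement : Node μ → Set
  Disagreement α = ∃[ β ] (toℕ (Q β) ≡ suc (toℕ (Q α)) × P β Fin.< P α)

  disagreement? : Decidable Disagreement
  disagreement? α = any-node? μ λ β →
    (toℕ (Q β) ℕ.≟ suc (toℕ (Q α))) ×-dec (P β Fin.<? P α)

  pedestal : Node μ → ℕ
  pedestal α = count μ λ β → (Q β Fin.<? Q α) ×-dec disagreement? β

  ∣pedestal∣ : ℕ
  ∣pedestal∣ = sum (map pedestal (nodes μ))

hookProduct : ∀ {n} → Partition n → PowerSeries
hookProduct μ = ∏ (map (λ α → 𝟙 ⊖ x^ hookLength μ α) (nodes μ))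

qPochhammer : ℕ → PowerSeries
qPochhammer n = ∏ (map (λ i → 𝟙 ⊖ x^ suc i) (upTo n))

π : ∀ {n} (μ : Partition n) → Filling μ → PowerSeries
π μ P = ⨁ (map (λ Q → x^ ∣pedestal∣ μ P Q) (𝔰𝔱 μ))

𝟙⊖x^-constant : ∀ {k} → 1 ℕ.≤ k → (𝟙 ⊖ x^ k) 0 ≡ 1ℤ
𝟙⊖x^-constant (ℕ.s≤s _) = refl

hookProduct-constant : ∀ {n} (μ : Partition n) → hookProduct μ 0 ≡ 1ℤ
hookProduct-constant μ = ∏-constant (All.map⁺ (All.universal
  (λ α → 𝟙⊖x^-constant (hookLength-positive μ α)) (nodes μ)))

qPochhammer-constant : ∀ n → qPochhammer n 0 ≡ 1ℤ
qPochhammer-constant n = ∏-constant (All.map⁺ (All.universal (λ _ → refl) (upTo n)))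

{-# OPTIONS --safe #-}
module Submission where

-- Both sides are the generating function, by the sum of the values, of the
-- order preserving maps f : λ → ℕ.
--
-- Left: building λ one corner at a time, a multiset of nodes is turned into
-- such a map.  A corner c of multiplicity a receives the entry a plus the
-- larger of its two neighbours, and each other entry on the diagonal of c is
-- replaced by (max of upper neighbours) + (min of lower neighbours) - itself,
-- which is an involution.  The sum of each diagonal is then the sum of the
-- multiplicities over the rectangle above the end of this diagonal, so that
-- adding c raises the total by the multiplicities in the row and the column of
-- c, that is, in the nodes whose hooks contain c.
--
-- Right: given f, order the nodes by value, breaking ties with P.  This is a
-- standard tableau Q, the P-pedestal of Q is the least f with this Q, and
-- f - q increases weakly along Q; such differences are the partitions into
-- parts of size at most n.

open import Data.Fin.Base as Fin using (Fin; toℕ; zero; suc; fromℕ<; punchOut)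
import Data.Fin.Properties as Fin
open import Data.Integer.Base as ℤ using (ℤ; 0ℤ; 1ℤ)
import Data.Integer.Properties as ℤ
import Data.Integer.Tactic.RingSolver as ℤSolver
open import Data.List.Base
  using (List; []; _∷_; _∷ʳ_; _++_; map; filter; length; lookup; allFin; upTo; tabulate)
import Data.List.Properties as List
open import Data.List.Membership.Propositional using (_∈_; _∉_)
open import Data.List.Membership.Propositional.Properties
  using (∈-map⁺; ∈-map⁻; ∈-allFin; ∈-lookup; ∈-upTo⁺; ∈-upTo⁻)
open import Data.List.Membership.Propositional.Properties.WithK using (unique∧set⇒bag)
open import Data.List.Relation.Binary.BagAndSetEquality using (∼bag⇒↭)
open import Data.List.Relation.Binary.Permutation.Propositional using (_↭_)
import Data.List.Relation.Binary.Permutation.Propositional.Properties as ↭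
open import Data.List.Relation.Unary.All as All using (All; []; _∷_)
import Data.List.Relation.Unary.All.Properties as All
open import Data.List.Relation.Unary.AllPairs as AllPairs using (AllPairs; []; _∷_)
import Data.List.Relation.Unary.AllPairs.Properties as AllPairs
open import Data.List.Relation.Unary.Any as Any using (Any; here; there)
import Data.List.Relation.Unary.Any.Properties as Any
open import Data.List.Relation.Unary.Linked using (Linked)
open import Data.List.Relation.Unary.Linked.Properties using (Linked⇒AllPairs)
open import Data.List.Relation.Unary.Unique.Propositional using (Unique)
import Data.List.Relation.Unary.Unique.Propositional.Properties as Unique
open import Data.Nat.Base as ℕ
  using (ℕ; zero; suc; _∸_; _+_; _*_; _≤_; _<_; _⊔_; _⊓_; z≤n; s≤s)
open import Data.Nat.Induction using (<-rec)
open import Data.Nat.ListAction using (sum)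
open import Data.Nat.ListAction.Properties using (sum-++; sum-↭)
import Data.Nat.Properties as ℕ
open import Data.Nat.Tactic.RingSolver using (solve-∀)
open import Data.Product.Base using (Σ-syntax; ∃-syntax; _×_; _,_; proj₁; proj₂)
open import Data.Product.Properties using (≡-dec)
open import Data.Product.Relation.Binary.Pointwise.NonDependent using (×-setoid)
open import Data.Sum.Base using (_⊎_; inj₁; inj₂)
open import Data.Unit.Base using (⊤; tt)
open import Data.Vec.Functional using (Vector)
open import Function.Base using (_∘_; id)
open import Function.Bundles using (_⇔_; mk⇔; module Equivalence)
open import Function.Consequences.Propositional using (strictlySurjective⇒surjective)
open import Function.Definitions using (Injective; StrictlySurjective)
open import Level using (0ℓ)
open import Relation.Binary.Bundles using (Setoid)
open import Relation.Binary.Definitions using (DecidableEquality; tri<; tri≈; tri>)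
open import Relation.Binary.PropositionalEquality hiding (setoid; [_])
import Relation.Binary.PropositionalEquality.Properties as ≡
open import Relation.Nullary using (Dec; yes; no; ¬_; contradiction)
open import Relation.Nullary.Decidable using (_×-dec_; _⊎-dec_)
open import Relation.Unary using (Pred; Decidable)
open import Algebra.Properties.Semiring.Sum ℤ.+-*-semiring
  using (sum-cong-≋; sum-replicate-zero; ∑-distrib-+) renaming (sum to Σℤ)
open import Defs

open Equivalence using (to; from)

-- Power series

-- A quotient of `f` by a product of factors `1 - x^h` enters only as the equation "product times
-- `g` is `f`". Taken one factor at a time, it is the recursion `g = f + x^h g`, and this is how the
-- numbers of objects at each level change when a multiplicity of weight `h` is adjoined to them.
-- Both quotients thus count multisets, and two bijections onto one graded set identify them.
-- Tableaux and maps are functions, so everything is counted up to pointwise equality.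
--
-- Hooks arise because the toggle makes diagonal sums obey the inclusion-exclusion rule of rectangle
-- sums: the minimum and the maximum of the same two entries add up to their sum.
--
-- The pedestal arises because ties of `f` are listed in the order of `P`: along `Q`, a step at
-- which `P` decreases cannot be a tie, so `f` has to jump exactly at the disagreement nodes.
--
-- `P` serves on both sides. On the left its entries fix the order in which corners are added, on
-- the right it breaks ties. That it is standard makes each box a corner when its turn comes, and
-- makes the sorted filling standard.

shift : ℕ → PowerSeries → PowerSeries
shift zero    f n       = f n
shift (suc h) f zero    = 0ℤ
shift (suc h) f (suc n) = shift h f n

shift-cong : ∀ h {f g} → f ≗ g → shift h f ≗ shift h g
shift-cong zero    f≗g n       = f≗g n
shift-cong (suc h) f≗g zero    = refl
shift-cong (suc h) f≗g (suc n) = shift-cong h f≗g n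

shift-+ : ∀ h k f → shift h (shift k f) ≗ shift (h + k) f
shift-+ zero    k f n       = refl
shift-+ (suc h) k f zero    = refl
shift-+ (suc h) k f (suc n) = shift-+ h k f n

shift-comm : ∀ h k f → shift h (shift k f) ≗ shift k (shift h f)
shift-comm h k f n = begin
  shift h (shift k f) n  ≡⟨ shift-+ h k f n ⟩
  shift (h + k) f n      ≡⟨ cong (λ l → shift l f n) (ℕ.+-comm h k) ⟩
  shift (k + h) f n      ≡⟨ shift-+ k h f n ⟨
  shift k (shift h f) n  ∎
  where open ≡-Reasoning

shift-⊖ : ∀ h f g → shift h (f ⊖ g) ≗ shift h f ⊖ shift h g
shift-⊖ zero    f g n       = refl
shift-⊖ (suc h) f g zero    = refl
shift-⊖ (suc h) f g (suc n) = shift-⊖ h f g n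

x^≗shift : ∀ h → x^ h ≗ shift h 𝟙
x^≗shift zero    n       = refl
x^≗shift (suc h) zero    = refl
x^≗shift (suc h) (suc n) = x^≗shift h n

shift-< : ∀ {h n} → n < h → ∀ f → shift h f n ≡ 0ℤ
shift-< {suc h} {zero}  _         f = refl
shift-< {suc h} {suc n} (s≤s n<h) f = shift-< n<h f

shift-≥ : ∀ h f n → shift h f (h + n) ≡ f n
shift-≥ zero    f n = refl
shift-≥ (suc h) f n = shift-≥ h f n

private
  interchange⁻ : ∀ a b s t → a ℤ.- b ℤ.+ (s ℤ.- t) ≡ a ℤ.+ s ℤ.- (b ℤ.+ t)
  interchange⁻ = ℤSolver.solve-∀

  *-distribʳ-∸ : ∀ a b c → (a ℤ.- b) ℤ.* c ≡ a ℤ.* c ℤ.- b ℤ.* c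
  *-distribʳ-∸ = ℤSolver.solve-∀

Σℤ-minus : ∀ {n} (a b : Vector ℤ n) → Σℤ (λ k → a k ℤ.- b k) ≡ Σℤ a ℤ.- Σℤ b
Σℤ-minus {zero}  a b = refl
Σℤ-minus {suc n} a b rewrite Σℤ-minus (a ∘ suc) (b ∘ suc) = interchange⁻ (a zero) (b zero) _ _

⊛-cong : ∀ {f f′ g g′} → f ≗ f′ → g ≗ g′ → f ⊛ g ≗ f′ ⊛ g′
⊛-cong p q n = sum-cong-≋ {suc n} λ k → cong₂ ℤ._*_ (p (toℕ k)) (q (n ∸ toℕ k))

⊖-⊛ : ∀ f g h → (f ⊖ g) ⊛ h ≗ (f ⊛ h) ⊖ (g ⊛ h)
⊖-⊛ f g h n = trans
  (sum-cong-≋ {suc n} λ k → *-distribʳ-∸ (f (toℕ k)) (g (toℕ k)) (h (n ∸ toℕ k)))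
  (Σℤ-minus {suc n} (λ k → f (toℕ k) ℤ.* h (n ∸ toℕ k)) (λ k → g (toℕ k) ℤ.* h (n ∸ toℕ k)))

⊕-⊛ : ∀ f g h → (f ⊕ g) ⊛ h ≗ (f ⊛ h) ⊕ (g ⊛ h)
⊕-⊛ f g h n = trans
  (sum-cong-≋ {suc n} λ k → ℤ.*-distribʳ-+ (h (n ∸ toℕ k)) (f (toℕ k)) (g (toℕ k)))
  (∑-distrib-+ {suc n} (λ k → f (toℕ k) ℤ.* h (n ∸ toℕ k)) (λ k → g (toℕ k) ℤ.* h (n ∸ toℕ k)))

⊛-distribˡ-⊕ : ∀ f g k → f ⊛ (g ⊕ k) ≗ (f ⊛ g) ⊕ (f ⊛ k)
⊛-distribˡ-⊕ f g k n = trans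
  (sum-cong-≋ {suc n} λ j → ℤ.*-distribˡ-+ (f (toℕ j)) (g (n ∸ toℕ j)) (k (n ∸ toℕ j)))
  (∑-distrib-+ {suc n} (λ j → f (toℕ j) ℤ.* g (n ∸ toℕ j)) (λ j → f (toℕ j) ℤ.* k (n ∸ toℕ j)))

⊛-zeroʳ : ∀ f → f ⊛ 𝟘 ≗ 𝟘
⊛-zeroʳ f n = trans (sum-cong-≋ {suc n} λ k → ℤ.*-zeroʳ (f (toℕ k))) (sum-replicate-zero (suc n))

𝟘-⊛ : ∀ g → 𝟘 ⊛ g ≗ 𝟘
𝟘-⊛ g n = trans (sum-cong-≋ {suc n} λ k → ℤ.*-zeroˡ (g (n ∸ toℕ k))) (sum-replicate-zero (suc n))

𝟙-⊛ : ∀ g → 𝟙 ⊛ g ≗ g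
𝟙-⊛ g n = begin
  1ℤ ℤ.* g n ℤ.+ Σℤ {n} (λ k → 0ℤ ℤ.* g (n ∸ suc (toℕ k)))
    ≡⟨ cong₂ ℤ._+_ (ℤ.*-identityˡ (g n))
         (trans (sum-cong-≋ {n} λ k → ℤ.*-zeroˡ (g (n ∸ suc (toℕ k)))) (sum-replicate-zero n)) ⟩
  g n ℤ.+ 0ℤ  ≡⟨ ℤ.+-identityʳ (g n) ⟩
  g n         ∎
  where open ≡-Reasoning

shift-⊛ : ∀ h f g → shift h f ⊛ g ≗ shift h (f ⊛ g)
shift-⊛ zero    f g n       = refl
shift-⊛ (suc h) f g zero    = trans (ℤ.+-identityʳ _) (ℤ.*-zeroˡ (g 0))
shift-⊛ (suc h) f g (suc n) = begin
  0ℤ ℤ.* g (suc n) ℤ.+ (shift h f ⊛ g) n  ≡⟨ cong (ℤ._+ (shift h f ⊛ g) n) (ℤ.*-zeroˡ (g (suc n))) ⟩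
  0ℤ ℤ.+ (shift h f ⊛ g) n                ≡⟨ ℤ.+-identityˡ _ ⟩
  (shift h f ⊛ g) n                       ≡⟨ shift-⊛ h f g n ⟩
  shift h (f ⊛ g) n                       ∎
  where open ≡-Reasoning

x^-⊛ : ∀ h g → (x^ h) ⊛ g ≗ shift h g
x^-⊛ h g n = begin
  ((x^ h) ⊛ g) n     ≡⟨ ⊛-cong {g = g} (x^≗shift h) (λ _ → refl) n ⟩
  (shift h 𝟙 ⊛ g) n  ≡⟨ shift-⊛ h 𝟙 g n ⟩
  shift h (𝟙 ⊛ g) n  ≡⟨ shift-cong h (𝟙-⊛ g) n ⟩
  shift h g n        ∎
  where open ≡-Reasoning

𝟙⊖x^-⊛ : ∀ h g → (𝟙 ⊖ x^ h) ⊛ g ≗ g ⊖ shift h g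
𝟙⊖x^-⊛ h g n = trans (⊖-⊛ 𝟙 (x^ h) g n) (cong₂ ℤ._-_ (𝟙-⊛ g n) (x^-⊛ h g n))

∏𝟙⊖x^ : {I : Set} → (I → ℕ) → List I → PowerSeries
∏𝟙⊖x^ h is = ∏ (map (λ i → 𝟙 ⊖ x^ h i) is)

module _ {I : Set} (h : I → ℕ) where

  -- A factor `1 - x^h` acts as `g ↦ g ⊖ shift h g`, the form in which `multisets-hasSeries`
  -- consumes the product one index at a time.
  ∏𝟙⊖x^-∷ : ∀ i is g → ∏𝟙⊖x^ h (i ∷ is) ⊛ g ≗ (∏𝟙⊖x^ h is ⊛ g) ⊖ shift (h i) (∏𝟙⊖x^ h is ⊛ g)
  ∏𝟙⊖x^-∷ i is g n = begin
    (((𝟙 ⊖ x^ h i) ⊛ p) ⊛ g) n                  ≡⟨ ⊛-cong {g = g} (𝟙⊖x^-⊛ (h i) p) (λ _ → refl) n ⟩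
    ((p ⊖ shift (h i) p) ⊛ g) n                 ≡⟨ ⊖-⊛ p (shift (h i) p) g n ⟩
    (p ⊛ g) n ℤ.- (shift (h i) p ⊛ g) n         ≡⟨ cong (ℤ._-_ ((p ⊛ g) n)) (shift-⊛ (h i) p g n) ⟩
    (p ⊛ g) n ℤ.- shift (h i) (p ⊛ g) n         ∎
    where
    open ≡-Reasoning
    p = ∏𝟙⊖x^ h is

  ∏𝟙⊖x^-shift : ∀ is k g → ∏𝟙⊖x^ h is ⊛ shift k g ≗ shift k (∏𝟙⊖x^ h is ⊛ g)
  ∏𝟙⊖x^-shift []       k g n = trans (𝟙-⊛ (shift k g) n) (sym (shift-cong k (𝟙-⊛ g) n))
  ∏𝟙⊖x^-shift (i ∷ is) k g n = begin
    (∏𝟙⊖x^ h (i ∷ is) ⊛ shift k g) n  ≡⟨ ∏𝟙⊖x^-∷ i is (shift k g) n ⟩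
    (p ⊛ shift k g) n ℤ.- shift (h i) (p ⊛ shift k g) n
      ≡⟨ cong₂ ℤ._-_ (∏𝟙⊖x^-shift is k g n) (shift-cong (h i) (∏𝟙⊖x^-shift is k g) n) ⟩
    shift k (p ⊛ g) n ℤ.- shift (h i) (shift k (p ⊛ g)) n
      ≡⟨ cong (ℤ._-_ (shift k (p ⊛ g) n)) (shift-comm (h i) k (p ⊛ g) n) ⟩
    shift k (p ⊛ g) n ℤ.- shift k (shift (h i) (p ⊛ g)) n
      ≡⟨ shift-⊖ k (p ⊛ g) (shift (h i) (p ⊛ g)) n ⟨
    shift k ((p ⊛ g) ⊖ shift (h i) (p ⊛ g)) n
      ≡⟨ shift-cong k (∏𝟙⊖x^-∷ i is g) n ⟨
    shift k (∏𝟙⊖x^ h (i ∷ is) ⊛ g) n  ∎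
    where
    open ≡-Reasoning
    p = ∏𝟙⊖x^ h is

  -- Each monomial acts as a shift, and a shift passes through the product, so every term reduces to
  -- the hypothesis on `g`. For tableaux this shows that `π μ P ⊛ (qPochhammer n) ⁻¹` solves the
  -- equation that `multisets-hasSeries` asks of a quotient.
  ∏𝟙⊖x^-⨁ : ∀ is g → ∏𝟙⊖x^ h is ⊛ g ≗ 𝟙 → ∀ {A : Set} (w : A → ℕ) as →
    ∏𝟙⊖x^ h is ⊛ (⨁ (map (λ a → x^ w a) as) ⊛ g) ≗ ⨁ (map (λ a → x^ w a) as)
  ∏𝟙⊖x^-⨁ is g inv w []       n =
    trans (⊛-cong {∏𝟙⊖x^ h is} (λ _ → refl) (𝟘-⊛ g) n) (⊛-zeroʳ (∏𝟙⊖x^ h is) n)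
  ∏𝟙⊖x^-⨁ is g inv w (a ∷ as) n = begin
    (p ⊛ ((x^ w a ⊕ s) ⊛ g)) n
      ≡⟨ ⊛-cong {p} (λ _ → refl) (λ m → trans (⊕-⊛ (x^ w a) s g m) (cong (ℤ._+ _) (x^-⊛ (w a) g m))) n ⟩
    (p ⊛ (shift (w a) g ⊕ (s ⊛ g))) n
      ≡⟨ ⊛-distribˡ-⊕ p (shift (w a) g) (s ⊛ g) n ⟩
    (p ⊛ shift (w a) g) n ℤ.+ (p ⊛ (s ⊛ g)) n
      ≡⟨ cong₂ ℤ._+_ (∏𝟙⊖x^-shift is (w a) g n) (∏𝟙⊖x^-⨁ is g inv w as n) ⟩
    shift (w a) (p ⊛ g) n ℤ.+ s n
      ≡⟨ cong (ℤ._+ s n) (trans (shift-cong (w a) inv n) (sym (x^≗shift (w a) n))) ⟩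
    (x^ w a) n ℤ.+ s n  ∎
    where
    open ≡-Reasoning
    p = ∏𝟙⊖x^ h is
    s = ⨁ (map (λ a → x^ w a) as)

-- Counting by weight

-- Validity stands beside the carrier instead of inside it, so that `≈` compares functions by their
-- values and never compares proofs.
record Graded : Set₁ where
  field
    setoid : Setoid 0ℓ 0ℓ
  open Setoid setoid public
  field
    Valid  : Carrier → Set
    weight : Carrier → ℕ
    weight-cong : ∀ {a b} → a ≈ b → weight a ≡ weight b

  infix 4 _∈Level_
  _∈Level_ : Carrier → ℕ → Set
  a ∈Level m = Valid a × weight a ≡ m

open Graded using (Carrier; Valid; weight)

record Enumeration (S : Graded) (m : ℕ) : Set where
  open Graded S using (_≈_; _∈Level_)
  field
    elements : List (Carrier S)
    sound    : All (_∈Level m) elements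
    distinct : AllPairs (λ a b → ¬ a ≈ b) elements
    complete : ∀ {a} → a ∈Level m → Any (a ≈_) elements

open Enumeration

infix 4 _HasSeries_
_HasSeries_ : Graded → PowerSeries → Set
S HasSeries f = ∀ m → Σ[ E ∈ Enumeration S m ] f m ≡ ℤ.+ length (elements E)

record _≅_ (S T : Graded) : Set where
  private
    module S = Graded S
    module T = Graded T
  field
    forward         : Carrier S → Carrier T
    preserves-≈      : ∀ {a b} → a S.≈ b → forward a T.≈ forward b
    valid      : ∀ {a} → Valid S a → Valid T (forward a)
    weighted   : ∀ {a} → Valid S a → weight T (forward a) ≡ weight S a
    injective  : ∀ {a b} → Valid S a → Valid S b → forward a T.≈ forward b → a S.≈ b
    surjective : ∀ {b} → Valid T b → ∃[ a ] Valid S a × forward a T.≈ b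

  enumeration : ∀ {m} → Enumeration S m → Enumeration T m
  enumeration E = record
    { elements = map forward (elements E)
    ; sound    = All.map⁺ (All.map (λ (v , w) → valid v , trans (weighted v) w) (sound E))
    ; distinct = distinct′ (sound E) (distinct E)
    ; complete = λ (v , w) → let a , va , e = surjective v in
        Any.map⁺ (Any.map (λ a≈x → T.trans (T.sym e) (preserves-≈ a≈x))
          (complete E (va , trans (sym (weighted va)) (trans (T.weight-cong e) w))))
    }
    where
    distinct′ : ∀ {m as} → All (S._∈Level m) as → AllPairs (λ a b → ¬ a S.≈ b) as →
      AllPairs (λ a b → ¬ a T.≈ b) (map forward as)
    distinct′ []       []       = []
    distinct′ (p ∷ ps) (q ∷ qs) = All.map⁺
      (All.zipWith (λ (p′ , a≉b) e → a≉b (injective (proj₁ p) (proj₁ p′) e)) (ps , q)) ∷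
      distinct′ ps qs

  hasSeries : ∀ {f} → S HasSeries f → T HasSeries f
  hasSeries s m = let E , e = s m in
    enumeration E , trans e (cong ℤ.+_ (sym (List.length-map forward (elements E))))

module _ {S : Graded} where
  private module S = Graded S

  distinct-lookup : ∀ {as} → AllPairs (λ a b → ¬ a S.≈ b) as →
    ∀ i j → lookup as i S.≈ lookup as j → i ≡ j
  distinct-lookup (p ∷ ps) zero    zero    e = refl
  distinct-lookup (p ∷ ps) zero    (suc j) e = contradiction e (All.lookup p (∈-lookup j))
  distinct-lookup (p ∷ ps) (suc i) zero    e = contradiction (S.sym e) (All.lookup p (∈-lookup i))
  distinct-lookup (p ∷ ps) (suc i) (suc j) e = cong suc (distinct-lookup ps i j e)

  -- Sending each position of `E` to the position of an equal element of `E′` is injective, since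
  -- the elements of `E` are pairwise distinct. Used in both directions, it makes the coefficient at
  -- level `m` independent of the enumeration.
  enumeration-≤ : ∀ {m} (E E′ : Enumeration S m) → length (elements E) ≤ length (elements E′)
  enumeration-≤ E E′ = Fin.injective⇒≤ {f = f} λ {i} {j} e → distinct-lookup (distinct E) i j
    (S.trans (f-≈ i) (S.trans (S.reflexive (cong (lookup (elements E′)) e)) (S.sym (f-≈ j))))
    where
    position : ∀ i → Any (lookup (elements E) i S.≈_) (elements E′)
    position i = complete E′ (All.lookup (sound E) (∈-lookup i))
    f : Fin (length (elements E)) → Fin (length (elements E′))
    f i = Any.index (position i)
    f-≈ : ∀ i → lookup (elements E) i S.≈ lookup (elements E′) (f i)
    f-≈ i = Any.lookup-index (position i)

  series-unique : ∀ {f g} → S HasSeries f → S HasSeries g → f ≗ g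
  series-unique s t m = let E , e = s m ; E′ , e′ = t m in
    trans e (trans (cong ℤ.+_ (ℕ.≤-antisym (enumeration-≤ E E′) (enumeration-≤ E′ E))) (sym e′))

infixr 2 ℕ[_]×_
ℕ[_]×_ : ℕ → Graded → Graded
ℕ[ h ]× S = record
  { setoid      = ×-setoid (≡.setoid ℕ) (Graded.setoid S)
  ; Valid       = λ (_ , a) → Valid S a
  ; weight      = λ (k , a) → h * k + weight S a
  ; weight-cong = λ (p , q) → cong₂ (λ k w → h * k + w) p (Graded.weight-cong S q)
  }

module _ {S : Graded} (h : ℕ) where
  private
    module S = Graded S
    h×S : Graded
    h×S = ℕ[ suc h ]× S
    module hS = Graded h×S

  zeroCopies : S.Carrier → hS.Carrier
  zeroCopies a = 0 , a

  oneMore : hS.Carrier → hS.Carrier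
  oneMore (k , a) = suc k , a

  ℕ×-small : ∀ {m} → m < suc h → Enumeration S m → Enumeration h×S m
  ℕ×-small m<h E = record
    { elements = map zeroCopies (elements E)
    ; sound    = All.map⁺ (All.map (λ (v , w) → v , cong₂ _+_ (ℕ.*-zeroʳ h) w) (sound E))
    ; distinct = AllPairs.map⁺ (AllPairs.map (λ a≉b (_ , e) → a≉b e) (distinct E))
    ; complete = λ
      { {zero , a}  (v , w) → Any.map⁺ (Any.map (refl ,_)
          (complete E (v , trans (cong (_+ weight S a) (sym (ℕ.*-zeroʳ h))) w)))
      ; {suc k , a} (v , refl) → contradiction m<h (ℕ.≤⇒≯ (ℕ.≤-trans (ℕ.m≤m*n (suc h) (suc k)) (ℕ.m≤m+n _ _)))
      }
    }

  -- An element either has multiplicity zero or can lose one copy, dropping from level `suc h + m`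
  -- to level `m`. The two sublists realise the terms `f` and `shift (suc h) g` of the recursion for
  -- `g`.
  ℕ×-large : ∀ {m} → Enumeration S (suc h + m) → Enumeration h×S m → Enumeration h×S (suc h + m)
  ℕ×-large {m} E E′ = record
    { elements = map zeroCopies (elements E) ++ map oneMore (elements E′)
    ; sound    = All.++⁺
        (All.map⁺ (All.map (λ {a} (v , w) → v , trans (cong (_+ weight S a) (ℕ.*-zeroʳ h)) w) (sound E)))
        (All.map⁺ (All.map (λ {(k , a)} (v , w) →
          v , trans (weight-oneMore k (weight S a)) (cong (ℕ._+_ (suc h)) w)) (sound E′)))
    ; distinct = AllPairs.++⁺
        (AllPairs.map⁺ (AllPairs.map (λ a≉b (_ , e) → a≉b e) (distinct E)))
        (AllPairs.map⁺ (AllPairs.map (λ ne (p , e) → ne (ℕ.suc-injective p , e)) (distinct E′)))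
        (All.map⁺ (All.universal (λ _ → All.map⁺ (All.universal (λ _ ()) _)) _))
    ; complete = λ
      { {zero , a}  (v , w) → Any.++⁺ˡ (Any.map⁺ (Any.map (refl ,_)
          (complete E (v , trans (cong (_+ weight S a) (sym (ℕ.*-zeroʳ h))) w))))
      ; {suc k , a} (v , w) → Any.++⁺ʳ _ (Any.map⁺ (Any.map (λ (p , e) → cong suc p , e)
          (complete E′ (v , ℕ.+-cancelˡ-≡ (suc h) _ _ (trans (sym (weight-oneMore k (weight S a))) w)))))
      }
    }
    where
    weight-oneMore : ∀ k w → suc h * suc k + w ≡ suc h + (suc h * k + w)
    weight-oneMore k w = trans (cong (_+ w) (ℕ.*-suc (suc h) k)) (ℕ.+-assoc (suc h) (suc h * k) w)

  -- The hypothesis amounts to `g = f + shift (suc h) g`. A copy has positive weight, so the shifted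
  -- term refers to lower levels only and strong induction applies.
  ℕ×-hasSeries : ∀ {f g} → S HasSeries f → (g ⊖ shift (suc h) g) ≗ f → h×S HasSeries g
  ℕ×-hasSeries {f} {g} s rec = <-rec _ step
    where
    g≡ : ∀ n → g n ≡ f n ℤ.+ shift (suc h) g n
    g≡ n = trans (lemma (g n) _) (cong (ℤ._+ shift (suc h) g n) (rec n))
      where
      lemma : ∀ a b → a ≡ a ℤ.- b ℤ.+ b
      lemma = ℤSolver.solve-∀
    Goal : ℕ → Set
    Goal m = Σ[ E ∈ Enumeration h×S m ] g m ≡ ℤ.+ length (elements E)
    step : ∀ m → (∀ {k} → k < m → Goal k) → Goal m
    step m ih with suc h ℕ.≤? m
    ... | no h≰m = let E , e = s m in ℕ×-small (ℕ.≰⇒> h≰m) E , (begin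
      g m                          ≡⟨ g≡ m ⟩
      f m ℤ.+ shift (suc h) g m    ≡⟨ cong (ℤ._+_ (f m)) (shift-< (ℕ.≰⇒> h≰m) g) ⟩
      f m ℤ.+ 0ℤ                   ≡⟨ ℤ.+-identityʳ (f m) ⟩
      f m                          ≡⟨ e ⟩
      ℤ.+ length (elements E)        ≡⟨ cong ℤ.+_ (List.length-map zeroCopies (elements E)) ⟨
      ℤ.+ length (map zeroCopies (elements E)) ∎)
      where open ≡-Reasoning
    ... | yes h≤m with k , refl ← ℕ.m≤n⇒∃[o]m+o≡n h≤m =
      let E , e = s m ; E′ , e′ = ih (s≤s (ℕ.m≤n+m k h)) in ℕ×-large E E′ , (begin
      g m                          ≡⟨ g≡ m ⟩
      f m ℤ.+ shift (suc h) g m    ≡⟨ cong₂ ℤ._+_ e (trans (shift-≥ (suc h) g k) e′) ⟩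
      ℤ.+ (length (elements E) + length (elements E′))
        ≡⟨ cong₂ (λ a b → ℤ.+ (a + b)) (List.length-map zeroCopies (elements E)) (List.length-map oneMore (elements E′)) ⟨
      ℤ.+ (length (map zeroCopies (elements E)) + length (map oneMore (elements E′)))
        ≡⟨ cong ℤ.+_ (List.length-++ (map zeroCopies (elements E))) ⟨
      ℤ.+ length (map zeroCopies (elements E) ++ map oneMore (elements E′)) ∎)
      where open ≡-Reasoning

ℕ×-series : ∀ {S h} → 1 ≤ h → ∀ {f g} → S HasSeries f → (g ⊖ shift h g) ≗ f →
  (ℕ[ h ]× S) HasSeries g
ℕ×-series {h = suc h} _ = ℕ×-hasSeries h

-- A multiset drawn from `is` is its multiplicity function, of which only the
-- values on `is` matter.
agreeOn : {I : Set} → List I → Setoid 0ℓ 0ℓ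
agreeOn {I} is = record
  { Carrier       = I → ℕ
  ; _≈_           = λ a b → ∀ {i} → i ∈ is → a i ≡ b i
  ; isEquivalence = record
    { refl  = λ _ → refl
    ; sym   = λ p i∈is → sym (p i∈is)
    ; trans = λ p q i∈is → trans (p i∈is) (q i∈is)
    }
  }

total-weight : {I : Set} → (I → ℕ) → List I → (I → ℕ) → ℕ
total-weight h is a = sum (map (λ i → h i * a i) is)

sum-map-cong : {I : Set} {f g : I → ℕ} (is : List I) → (∀ {i} → i ∈ is → f i ≡ g i) →
  sum (map f is) ≡ sum (map g is)
sum-map-cong []       p = refl
sum-map-cong (i ∷ is) p = cong₂ _+_ (p (here refl)) (sum-map-cong is (p ∘ there))

Multisets : {I : Set} → (I → ℕ) → List I → Graded → Graded
Multisets h is S = record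
  { setoid      = ×-setoid (agreeOn is) (Graded.setoid S)
  ; Valid       = λ (_ , s) → Valid S s
  ; weight      = λ (a , s) → total-weight h is a + weight S s
  ; weight-cong = λ (p , q) → cong₂ _+_ (sum-map-cong is λ i∈is → cong (h _ *_) (p i∈is)) (Graded.weight-cong S q)
  }

module _ {I : Set} (_≟_ : DecidableEquality I) (h : I → ℕ) where

  insert : I → ℕ → (I → ℕ) → I → ℕ
  insert i k a j with i ≟ j
  ... | yes _ = k
  ... | no  _ = a j

  insert-≡ : ∀ i k a → insert i k a i ≡ k
  insert-≡ i k a with i ≟ i
  ... | yes _ = refl
  ... | no ¬p = contradiction refl ¬p

  insert-≢ : ∀ {i j} k a → i ≢ j → insert i k a j ≡ a j
  insert-≢ {i} {j} k a i≢j with i ≟ j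
  ... | yes p = contradiction p i≢j
  ... | no  _ = refl

  insert-self : ∀ i a j → insert i (a i) a j ≡ a j
  insert-self i a j with i ≟ j
  ... | yes refl = refl
  ... | no  _    = refl

  multisets-∷ : ∀ {i is} {S} → Unique (i ∷ is) → Multisets h is (ℕ[ h i ]× S) ≅ Multisets h (i ∷ is) S
  multisets-∷ {i} {is} {S} (i∉is ∷ _) = record
    { forward         = λ (a , k , s) → insert i k a , s
    ; preserves-≈      = λ { {a , k , _} {b , _ , _} (p , refl , q) → (λ
        { (here refl) → trans (insert-≡ i k a) (sym (insert-≡ i k b))
        ; (there j∈is) → trans (new k a j∈is) (trans (p j∈is) (sym (new k b j∈is))) }) , q }
    ; valid      = id
    ; weighted   = λ { {a , k , s} v → trans
        (cong (_+ weight S s) (cong₂ _+_ (cong (h i *_) (insert-≡ i k a))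
          (sum-map-cong is λ j∈is → cong (h _ *_) (new k a j∈is))))
        (rearrange (h i * k) _ _) }
    ; injective  = λ { {a , k , _} {b , l , _} _ _ (p , q) →
        (λ j∈is → trans (sym (new k a j∈is)) (trans (p (there j∈is)) (new l b j∈is))) ,
        trans (sym (insert-≡ i k a)) (trans (p (here refl)) (insert-≡ i l b)) , q }
    ; surjective = λ { {a , s} v → (a , a i , s) , v , (λ {j} _ → insert-self i a j) , Graded.refl S }
    }
    where
    new : ∀ k a {j} → j ∈ is → insert i k a j ≡ a j
    new k a j∈is = insert-≢ k a (All.lookup i∉is j∈is)
    rearrange : ∀ x y z → x + y + z ≡ y + (x + z)
    rearrange = solve-∀

  -- The base structure `S` varies in the induction: the copies of the head `i` are absorbed into
  -- it, and its series becomes `∏𝟙⊖x^ h is ⊛ g`, the quotient of `f` by the factor of `i`.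
  multisets-hasSeries : ∀ {is} → Unique is → All (λ i → 1 ≤ h i) is → ∀ {S f g} → S HasSeries f →
    ∏𝟙⊖x^ h is ⊛ g ≗ f → Multisets h is S HasSeries g
  multisets-hasSeries {[]} u [] {S} {f} {g} s e = _≅_.hasSeries iso
    (λ m → let E , p = s m in E , trans (trans (sym (𝟙-⊛ g m)) (e m)) p)
    where
    iso : S ≅ Multisets h [] S
    iso = record
      { forward         = (λ _ → 0) ,_
      ; preserves-≈      = λ e → (λ _ → refl) , e
      ; valid      = id
      ; weighted   = λ _ → refl
      ; injective  = λ _ _ (_ , e) → e
      ; surjective = λ { {_ , s} v → s , v , (λ ()) , Graded.refl S }
      }
  multisets-hasSeries {i ∷ is} u@(_ ∷ u′) (h≥1 ∷ hs≥1) {S} {f} {g} s e = _≅_.hasSeries (multisets-∷ {S = S} u)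
    (multisets-hasSeries u′ hs≥1
      (ℕ×-series h≥1 s λ n → trans (sym (∏𝟙⊖x^-∷ h i is g n)) (e n)) (λ _ → refl))

-- Robinson–Schensted–Knuth by toggles

Box : Set
Box = ℕ × ℕ

_≟ᵇ_ : DecidableEquality Box
_≟ᵇ_ = ≡-dec ℕ._≟_ ℕ._≟_

infix 4 _⊑_
_⊑_ : Box → Box → Set
(i , j) ⊑ (r , s) = i ≤ r × j ≤ s

⊑-trans : ∀ {u v w} → u ⊑ v → v ⊑ w → u ⊑ w
⊑-trans (p , q) (p′ , q′) = ℕ.≤-trans p p′ , ℕ.≤-trans q q′

Addable : Box → List Box → Set
Addable c L = c ∉ L × (∀ {u} → u ⊑ c → u ≢ c → u ∈ L)

-- Records a growth history, the box added last at the head. All inductions on a diagram follow it.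
data Diagram : List Box → Set where
  []  : Diagram []
  _∷_ : ∀ {c L} → Addable c L → Diagram L → Diagram (c ∷ L)

⊑-closed : ∀ {L u v} → Diagram L → v ⊑ u → u ∈ L → v ∈ L
⊑-closed {v = v} (_∷_ {c} (_ , below) D) v⊑u (here refl) with v ≟ᵇ c
... | yes v≡c = here v≡c
... | no  v≢c = there (below v⊑u v≢c)
⊑-closed (_ ∷ D) v⊑u (there u∈L) = there (⊑-closed D v⊑u u∈L)

-- Entries outside the quadrant are 0.
upEntry leftEntry lower upper : (Box → ℕ) → Box → ℕ
upEntry   φ (zero  , j) = 0
upEntry   φ (suc i , j) = φ (i , j)
leftEntry φ (i , zero)  = 0
leftEntry φ (i , suc j) = φ (i , j)
lower φ u       = upEntry φ u ⊔ leftEntry φ u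
upper φ (i , j) = φ (suc i , j) ⊓ φ (i , suc j)

ReversePlanePartition : List Box → (Box → ℕ) → Set
ReversePlanePartition L φ = ∀ {u} → u ∈ L → lower φ u ≤ φ u

infix 4 _≈⟨_⟩_
_≈⟨_⟩_ : (Box → ℕ) → List Box → (Box → ℕ) → Set
φ ≈⟨ L ⟩ ρ = ∀ {u} → u ∈ L → φ u ≡ ρ u

OnDiagonal : Box → Box → Set
OnDiagonal (r , s) (i , j) = i + s ≡ j + r

onDiagonal? : ∀ c → Decidable (OnDiagonal c)
onDiagonal? (r , s) (i , j) = i + s ℕ.≟ j + r

-- Acts along the whole infinite diagonal, but only the values on the diagram matter. When `c` is
-- addable, a box of the diagram on this diagonal has its neighbours below and to the right in the
-- diagram too, so in a reverse plane partition `φ u ≤ upper φ u` and the truncated subtraction is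
-- exact.
toggle : Box → (Box → ℕ) → Box → ℕ
toggle c φ u with onDiagonal? c u
... | yes _ = lower φ u + upper φ u ∸ φ u
... | no  _ = φ u

extend : Box → ℕ → (Box → ℕ) → Box → ℕ
extend c a φ u with u ≟ᵇ c
... | yes _ = a + lower φ c
... | no  _ = toggle c φ u

fromMultiplicities : List Box → (Box → ℕ) → Box → ℕ
fromMultiplicities []      A = A
fromMultiplicities (c ∷ L) A = extend c (A c) (fromMultiplicities L A)

toMultiplicities : List Box → (Box → ℕ) → Box → ℕ
toMultiplicities []      φ = φ
toMultiplicities (c ∷ L) φ u with u ≟ᵇ c
... | yes _ = φ c ∸ lower φ c
... | no  _ = toMultiplicities L (toggle c φ) u

toggle-on : ∀ {c u} φ → OnDiagonal c u → toggle c φ u ≡ lower φ u + upper φ u ∸ φ u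
toggle-on {c} {u} φ on with onDiagonal? c u
... | yes _ = refl
... | no ¬p = contradiction on ¬p

toggle-off : ∀ {c u} φ → ¬ OnDiagonal c u → toggle c φ u ≡ φ u
toggle-off {c} {u} φ off with onDiagonal? c u
... | yes p = contradiction p off
... | no  _ = refl

extend-≡ : ∀ c a φ → extend c a φ c ≡ a + lower φ c
extend-≡ c a φ with c ≟ᵇ c
... | yes _ = refl
... | no ¬p = contradiction refl ¬p

extend-≢ : ∀ {c u} a φ → u ≢ c → extend c a φ u ≡ toggle c φ u
extend-≢ {c} {u} a φ u≢c with u ≟ᵇ c
... | yes p = contradiction p u≢c
... | no  _ = refl

extend-off : ∀ {c u} a φ → ¬ OnDiagonal c u → extend c a φ u ≡ φ u
extend-off {r , s} {u} a φ off =
  trans (extend-≢ {u = u} a φ λ { refl → off (ℕ.+-comm r s) }) (toggle-off {r , s} {u} φ off)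

toMultiplicities-≡ : ∀ c L φ → toMultiplicities (c ∷ L) φ c ≡ φ c ∸ lower φ c
toMultiplicities-≡ c L φ with c ≟ᵇ c
... | yes _ = refl
... | no ¬p = contradiction refl ¬p

toMultiplicities-≢ : ∀ {c u} L φ → u ≢ c → toMultiplicities (c ∷ L) φ u ≡ toMultiplicities L (toggle c φ) u
toMultiplicities-≢ {c} {u} L φ u≢c with u ≟ᵇ c
... | yes p = contradiction p u≢c
... | no  _ = refl

lower-cong : ∀ {φ ρ} u → (∀ {v} → v ⊑ u → v ≢ u → φ v ≡ ρ v) → lower φ u ≡ lower ρ u
lower-cong {φ} {ρ} (i , j) e = cong₂ _⊔_ (up i e) (left j e)
  where
  up : ∀ i → (∀ {v} → v ⊑ (i , j) → v ≢ (i , j) → φ v ≡ ρ v) → upEntry φ (i , j) ≡ upEntry ρ (i , j)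
  up zero    e = refl
  up (suc i) e = e (ℕ.n≤1+n i , ℕ.≤-refl) λ ()
  left : ∀ j → (∀ {v} → v ⊑ (i , j) → v ≢ (i , j) → φ v ≡ ρ v) → leftEntry φ (i , j) ≡ leftEntry ρ (i , j)
  left zero    e = refl
  left (suc j) e = e (ℕ.≤-refl , ℕ.n≤1+n j) λ ()

module _ {c : Box} {φ ρ : Box → ℕ} (off : ∀ {v} → ¬ OnDiagonal c v → φ v ≡ ρ v) where

  -- The four neighbours of a box lie on the two adjacent diagonals, which a toggle leaves alone.
  -- Hence the boxes of one diagonal are toggled independently of each other, between fixed bounds.
  lower-diagonal : ∀ {u} → OnDiagonal c u → lower φ u ≡ lower ρ u
  lower-diagonal {i , j} on = cong₂ _⊔_ (up i on) (left j on)
    where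
    up : ∀ i → OnDiagonal c (i , j) → upEntry φ (i , j) ≡ upEntry ρ (i , j)
    up zero    on = refl
    up (suc i) on = off λ on′ → ℕ.1+n≢n (trans on (sym on′))
    left : ∀ j → OnDiagonal c (i , j) → leftEntry φ (i , j) ≡ leftEntry ρ (i , j)
    left zero    on = refl
    left (suc j) on = off λ on′ → ℕ.1+n≢n (trans (sym on) on′)

  upper-diagonal : ∀ {u} → OnDiagonal c u → upper φ u ≡ upper ρ u
  upper-diagonal {i , j} on = cong₂ _⊓_
    (off λ on′ → ℕ.1+n≢n (trans on′ (sym on)))
    (off λ on′ → ℕ.1+n≢n (trans (sym on′) on))

lower-rpp : ∀ {L φ} → (∀ {i j} → (suc i , j) ∈ L → φ (i , j) ≤ φ (suc i , j)) →
  (∀ {i j} → (i , suc j) ∈ L → φ (i , j) ≤ φ (i , suc j)) → ReversePlanePartition L φ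
lower-rpp {L} {φ} col row {i , j} u∈L = ℕ.⊔-lub (up i u∈L) (left j u∈L)
  where
  up : ∀ i → (i , j) ∈ L → upEntry φ (i , j) ≤ φ (i , j)
  up zero    _ = z≤n
  up (suc i)   = col
  left : ∀ j → (i , j) ∈ L → leftEntry φ (i , j) ≤ φ (i , j)
  left zero    _ = z≤n
  left (suc j)   = row

module _ {L} {φ : Box → ℕ} (rpp : ReversePlanePartition L φ) where

  column-step : ∀ {i j} → (suc i , j) ∈ L → φ (i , j) ≤ φ (suc i , j)
  column-step u∈L = ℕ.≤-trans (ℕ.m≤m⊔n _ _) (rpp u∈L)

  row-step : ∀ {i j} → (i , suc j) ∈ L → φ (i , j) ≤ φ (i , suc j)
  row-step u∈L = ℕ.≤-trans (ℕ.m≤n⊔m _ _) (rpp u∈L)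

  row-mono : Diagram L → ∀ {i j} s → j ≤ s → (i , s) ∈ L → φ (i , j) ≤ φ (i , s)
  row-mono D zero    z≤n   _   = ℕ.≤-refl
  row-mono D (suc s) j≤1+s v∈L with ℕ.m≤n⇒m<n∨m≡n j≤1+s
  ... | inj₂ refl      = ℕ.≤-refl
  ... | inj₁ (s≤s j≤s) = ℕ.≤-trans
    (row-mono D s j≤s (⊑-closed D (ℕ.≤-refl , ℕ.n≤1+n s) v∈L)) (row-step v∈L)

  column-mono : Diagram L → ∀ {i j} r → i ≤ r → (r , j) ∈ L → φ (i , j) ≤ φ (r , j)
  column-mono D zero    z≤n   _   = ℕ.≤-refl
  column-mono D (suc r) i≤1+r v∈L with ℕ.m≤n⇒m<n∨m≡n i≤1+r
  ... | inj₂ refl      = ℕ.≤-refl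
  ... | inj₁ (s≤s i≤r) = ℕ.≤-trans
    (column-mono D r i≤r (⊑-closed D (ℕ.n≤1+n r , ℕ.≤-refl) v∈L)) (column-step v∈L)

  rpp-mono : Diagram L → ∀ {u v} → u ⊑ v → v ∈ L → φ u ≤ φ v
  rpp-mono D {i , j} {r , s} (i≤r , j≤s) v∈L = ℕ.≤-trans
    (column-mono D r i≤r (⊑-closed D (ℕ.≤-refl , j≤s) v∈L)) (row-mono D s j≤s v∈L)

rpp-cong : ∀ {L φ ρ} → Diagram L → φ ≈⟨ L ⟩ ρ → ReversePlanePartition L φ → ReversePlanePartition L ρ
rpp-cong D e rpp {u} u∈L = subst₂ _≤_
  (lower-cong u λ v⊑u _ → e (⊑-closed D v⊑u u∈L)) (e u∈L) (rpp u∈L)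

module _ {c L} (add : Addable c L) (D : Diagram L) where

  private
    c∉L   = proj₁ add
    below = proj₂ add

  ∈⇒≢ : ∀ {u} → u ∈ L → u ≢ c
  ∈⇒≢ u∈L refl = c∉L u∈L

  -- A diagonal is a chain for `⊑`, so a box on it that is not strictly above and left of `c`
  -- dominates `c`, and closure would put `c` into `L`. The mixed cases contradict the equation of
  -- the diagonal.
  diagonal-< : ∀ {i j} → (i , j) ∈ L → OnDiagonal c (i , j) → i < proj₁ c × j < proj₂ c
  diagonal-< {i} {j} u∈L on with i ℕ.<? proj₁ c | j ℕ.<? proj₂ c
  ... | yes p | yes q = p , q
  ... | yes p | no ¬q = contradiction on
    (ℕ.<⇒≢ (subst (i + proj₂ c <_) (ℕ.+-comm (proj₁ c) j) (ℕ.+-mono-<-≤ p (ℕ.≮⇒≥ ¬q))))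
  ... | no ¬p | yes q = contradiction on
    (ℕ.>⇒≢ (subst (j + proj₁ c <_) (ℕ.+-comm (proj₂ c) i) (ℕ.+-mono-<-≤ q (ℕ.≮⇒≥ ¬p))))
  ... | no ¬p | no ¬q = contradiction (⊑-closed D (ℕ.≮⇒≥ ¬p , ℕ.≮⇒≥ ¬q) u∈L) c∉L

  diagonal-down : ∀ {i j} → (i , j) ∈ L → OnDiagonal c (i , j) → (suc i , j) ∈ L
  diagonal-down u∈L on = let p , q = diagonal-< u∈L on in
    below (p , ℕ.<⇒≤ q) λ { refl → ℕ.<-irrefl refl q }

  diagonal-right : ∀ {i j} → (i , j) ∈ L → OnDiagonal c (i , j) → (i , suc j) ∈ L
  diagonal-right u∈L on = let p , q = diagonal-< u∈L on in
    below (ℕ.<⇒≤ p , q) λ { refl → ℕ.<-irrefl refl p }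

  toggle-cong : ∀ {φ ρ} → φ ≈⟨ L ⟩ ρ → toggle c φ ≈⟨ L ⟩ toggle c ρ
  toggle-cong e {u} u∈L with onDiagonal? c u
  ... | no  _  = e u∈L
  ... | yes on = cong₂ _∸_
    (cong₂ _+_ (lower-cong u λ v⊑u _ → e (⊑-closed D v⊑u u∈L))
      (cong₂ _⊓_ (e (diagonal-down u∈L on)) (e (diagonal-right u∈L on))))
    (e u∈L)

  extend-≈ : ∀ a φ → extend c a φ ≈⟨ L ⟩ toggle c φ
  extend-≈ a φ u∈L = extend-≢ a φ (∈⇒≢ u∈L)

  lower-cong-c : ∀ {φ ρ} → φ ≈⟨ L ⟩ ρ → lower φ c ≡ lower ρ c
  lower-cong-c e = lower-cong c λ v⊑c v≢c → e (below v⊑c v≢c)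

  on-c : OnDiagonal c c
  on-c = ℕ.+-comm (proj₁ c) (proj₂ c)

  module _ {φ} (rpp : ReversePlanePartition L φ) where

    ≤-upper : ∀ {u} → u ∈ L → OnDiagonal c u → φ u ≤ upper φ u
    ≤-upper u∈L on = ℕ.⊓-glb (column-step rpp (diagonal-down u∈L on)) (row-step rpp (diagonal-right u∈L on))

    toggle-≥ : ∀ {u} → u ∈ L → OnDiagonal c u → lower φ u ≤ toggle c φ u
    toggle-≥ {u} u∈L on = begin
      lower φ u                      ≡⟨ ℕ.m+n∸n≡m (lower φ u) (φ u) ⟨
      lower φ u + φ u ∸ φ u          ≤⟨ ℕ.∸-monoˡ-≤ (φ u) (ℕ.+-monoʳ-≤ (lower φ u) (≤-upper u∈L on)) ⟩
      lower φ u + upper φ u ∸ φ u    ≡⟨ toggle-on φ on ⟨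
      toggle c φ u                   ∎
      where open ℕ.≤-Reasoning

    toggle-≤ : ∀ {u} → u ∈ L → OnDiagonal c u → toggle c φ u ≤ upper φ u
    toggle-≤ {u} u∈L on = begin
      toggle c φ u                   ≡⟨ toggle-on φ on ⟩
      lower φ u + upper φ u ∸ φ u    ≤⟨ ℕ.∸-monoˡ-≤ (φ u) (ℕ.+-monoˡ-≤ (upper φ u) (rpp u∈L)) ⟩
      φ u + upper φ u ∸ φ u          ≡⟨ ℕ.m+n∸m≡n (φ u) (upper φ u) ⟩
      upper φ u                      ∎
      where open ℕ.≤-Reasoning

    -- The toggle reflects `φ u` in the interval from `lower φ u` to `upper φ u`, whose ends stay
    -- fixed. A box off the diagonal may see a changed neighbour, but the new entry there is still
    -- at most its own `upper`, hence at most the entry of the box.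
    toggle-rpp : ReversePlanePartition L (toggle c φ)
    toggle-rpp {u} u∈L with onDiagonal? c u
    ... | yes on = subst₂ _≤_ (sym (lower-diagonal {c} (toggle-off φ) on)) (toggle-on φ on) (toggle-≥ u∈L on)
    ... | no off = lower-rpp′ u∈L off
      where
      step : ∀ {i j v} → v ∈ L → (i , j) ∈ L → upper φ (i , j) ≤ φ v → φ (i , j) ≤ φ v → toggle c φ (i , j) ≤ φ v
      step {i} {j} v∈L w∈L p q with onDiagonal? c (i , j)
      ... | no  _  = q
      ... | yes on = ℕ.≤-trans (subst (_≤ upper φ (i , j)) (toggle-on φ on) (toggle-≤ w∈L on)) p
      lower-rpp′ : ∀ {u} → u ∈ L → ¬ OnDiagonal c u → lower (toggle c φ) u ≤ φ u
      lower-rpp′ {i , j} u∈L off = ℕ.⊔-lub (up i u∈L) (left j u∈L)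
        where
        up : ∀ i → (i , j) ∈ L → upEntry (toggle c φ) (i , j) ≤ φ (i , j)
        up zero    _   = z≤n
        up (suc i) u∈L = step u∈L (⊑-closed D (ℕ.n≤1+n i , ℕ.≤-refl) u∈L) (ℕ.m⊓n≤m _ _) (column-step rpp u∈L)
        left : ∀ j → (i , j) ∈ L → leftEntry (toggle c φ) (i , j) ≤ φ (i , j)
        left zero    _   = z≤n
        left (suc j) u∈L = step u∈L (⊑-closed D (ℕ.≤-refl , ℕ.n≤1+n j) u∈L) (ℕ.m⊓n≤n (φ (suc i , j)) _) (row-step rpp u∈L)

    toggle-involutive : toggle c (toggle c φ) ≈⟨ L ⟩ φ
    toggle-involutive {u} u∈L = case (onDiagonal? c u)
      where
      case : Dec (OnDiagonal c u) → toggle c (toggle c φ) u ≡ φ u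
      case (no off) = trans (toggle-off {c} {u} (toggle c φ) off) (toggle-off {c} {u} φ off)
      case (yes on) = begin
        toggle c (toggle c φ) u
          ≡⟨ toggle-on {c} {u} (toggle c φ) on ⟩
        lower (toggle c φ) u + upper (toggle c φ) u ∸ toggle c φ u
          ≡⟨ cong₂ _∸_ (cong₂ _+_ (lower-diagonal {c} (λ {v} → toggle-off {c} {v} φ) {u} on)
               (upper-diagonal {c} (λ {v} → toggle-off {c} {v} φ) {u} on))
               (toggle-on {c} {u} φ on) ⟩
        lower φ u + upper φ u ∸ (lower φ u + upper φ u ∸ φ u)
          ≡⟨ ℕ.m∸[m∸n]≡n (ℕ.≤-trans (≤-upper u∈L on) (ℕ.m≤n+m (upper φ u) (lower φ u))) ⟩
        φ u  ∎
        where open ≡-Reasoning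

  extend-lower : ∀ a φ → lower (extend c a φ) c ≡ lower φ c
  extend-lower a φ = lower-diagonal {c} (extend-off a φ) on-c

  toggle-lower : ∀ φ → lower (toggle c φ) c ≡ lower φ c
  toggle-lower φ = lower-diagonal {c} (toggle-off φ) on-c

  extend-rpp : ∀ {a φ} → ReversePlanePartition L φ → ReversePlanePartition (c ∷ L) (extend c a φ)
  extend-rpp {a} {φ} rpp (here refl)  =
    subst₂ _≤_ (sym (extend-lower a φ)) (sym (extend-≡ c a φ)) (ℕ.m≤n+m (lower φ c) a)
  extend-rpp {a} {φ} rpp (there u∈L) = rpp-cong D (sym ∘ extend-≈ a φ) (toggle-rpp rpp) u∈L

fromMultiplicities-cong : ∀ {L} → Diagram L → ∀ {A B} → A ≈⟨ L ⟩ B →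
  fromMultiplicities L A ≈⟨ L ⟩ fromMultiplicities L B
fromMultiplicities-cong {c ∷ L} (add ∷ D) {A} {B} e (here refl) = trans (extend-≡ c _ _)
  (trans (cong₂ _+_ (e (here refl)) (lower-cong-c add D (fromMultiplicities-cong D (e ∘ there))))
    (sym (extend-≡ c _ _)))
fromMultiplicities-cong {c ∷ L} (add ∷ D) {A} {B} e (there u∈L) =
  trans (extend-≈ add D _ _ u∈L) (trans
    (toggle-cong add D (fromMultiplicities-cong D (e ∘ there)) u∈L) (sym (extend-≈ add D _ _ u∈L)))

toMultiplicities-cong : ∀ {L} → Diagram L → ∀ {φ ρ} → φ ≈⟨ L ⟩ ρ →
  toMultiplicities L φ ≈⟨ L ⟩ toMultiplicities L ρ
toMultiplicities-cong {c ∷ L} (add ∷ D) e (here refl) = trans (toMultiplicities-≡ c L _)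
  (trans (cong₂ _∸_ (e (here refl)) (lower-cong-c add D (e ∘ there))) (sym (toMultiplicities-≡ c L _)))
toMultiplicities-cong {c ∷ L} (add ∷ D) e (there u∈L) = trans (toMultiplicities-≢ L _ (∈⇒≢ add D u∈L))
  (trans (toMultiplicities-cong D (toggle-cong add D (e ∘ there)) u∈L)
    (sym (toMultiplicities-≢ L _ (∈⇒≢ add D u∈L))))

fromMultiplicities-rpp : ∀ {L} → Diagram L → ∀ A → ReversePlanePartition L (fromMultiplicities L A)
fromMultiplicities-rpp (add ∷ D) A = extend-rpp add D (fromMultiplicities-rpp D A)

from∘to : ∀ {L} → Diagram L → ∀ {φ} → ReversePlanePartition L φ →
  fromMultiplicities L (toMultiplicities L φ) ≈⟨ L ⟩ φ
from∘to {c ∷ L} (add ∷ D) {φ} rpp = go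
  where
  A = toMultiplicities (c ∷ L) φ
  ih : fromMultiplicities L A ≈⟨ L ⟩ toggle c φ
  ih v∈L = trans (fromMultiplicities-cong D (λ w∈L → toMultiplicities-≢ L φ (∈⇒≢ add D w∈L)) v∈L)
    (from∘to D (toggle-rpp add D (rpp ∘ there)) v∈L)
  open ≡-Reasoning
  go : fromMultiplicities (c ∷ L) A ≈⟨ c ∷ L ⟩ φ
  go (here refl) = begin
    extend c (A c) (fromMultiplicities L A) c  ≡⟨ extend-≡ c (A c) _ ⟩
    A c + lower (fromMultiplicities L A) c     ≡⟨ cong₂ _+_ (toMultiplicities-≡ c L φ) (lower-cong-c add D ih) ⟩
    φ c ∸ lower φ c + lower (toggle c φ) c     ≡⟨ cong (φ c ∸ lower φ c +_) (toggle-lower add D φ) ⟩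
    φ c ∸ lower φ c + lower φ c                ≡⟨ ℕ.m∸n+n≡m (rpp (here refl)) ⟩
    φ c                                        ∎
  go {u} (there u∈L) = begin
    extend c (A c) (fromMultiplicities L A) u  ≡⟨ extend-≈ add D (A c) _ u∈L ⟩
    toggle c (fromMultiplicities L A) u        ≡⟨ toggle-cong add D ih u∈L ⟩
    toggle c (toggle c φ) u                    ≡⟨ toggle-involutive add D (rpp ∘ there) u∈L ⟩
    φ u                                        ∎

to∘from : ∀ {L} → Diagram L → ∀ A → toMultiplicities L (fromMultiplicities L A) ≈⟨ L ⟩ A
to∘from {c ∷ L} (add ∷ D) A = go
  where
  open ≡-Reasoning
  ρ = fromMultiplicities L A
  φ = extend c (A c) ρ
  go : toMultiplicities (c ∷ L) φ ≈⟨ c ∷ L ⟩ A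
  go (here refl) = begin
    toMultiplicities (c ∷ L) φ c   ≡⟨ toMultiplicities-≡ c L φ ⟩
    φ c ∸ lower φ c                ≡⟨ cong₂ _∸_ (extend-≡ c (A c) ρ) (extend-lower add D (A c) ρ) ⟩
    A c + lower ρ c ∸ lower ρ c    ≡⟨ ℕ.m+n∸n≡m (A c) (lower ρ c) ⟩
    A c                            ∎
  go {u} (there u∈L) = begin
    toMultiplicities (c ∷ L) φ u       ≡⟨ toMultiplicities-≢ L φ (∈⇒≢ add D u∈L) ⟩
    toMultiplicities L (toggle c φ) u  ≡⟨ toMultiplicities-cong D (λ v∈L → trans
                                            (toggle-cong add D (extend-≈ add D (A c) ρ) v∈L)
                                            (toggle-involutive add D (fromMultiplicities-rpp D A) v∈L)) u∈L ⟩
    toMultiplicities L ρ u             ≡⟨ to∘from D A u∈L ⟩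
    A u                                ∎

-- Sums over rows, columns, diagonals and rectangles

sumBelow : ℕ → (ℕ → ℕ) → ℕ
sumBelow zero    f = 0
sumBelow (suc k) f = f k + sumBelow k f

module _ {S : Pred Box 0ℓ} (S? : Decidable S) where

  -- Moving two list sums across the equality avoids a subtraction.
  sum-off-filter : ∀ {f g : Box → ℕ} L → (∀ {u} → u ∈ L → ¬ S u → f u ≡ g u) →
    sum (map f L) + sum (map g (filter S? L)) ≡ sum (map g L) + sum (map f (filter S? L))
  sum-off-filter []      e = refl
  sum-off-filter {f} {g} (u ∷ L) e with S? u | sum-off-filter L (e ∘ there)
  ... | yes _ | ih = begin
    f u + a + (g u + b)    ≡⟨ interchange (f u) a (g u) b ⟩
    g u + f u + (a + b)    ≡⟨ cong (g u + f u +_) ih ⟩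
    g u + f u + (c + d)    ≡⟨ interchange′ (g u) c (f u) d ⟨
    g u + c + (f u + d)    ∎
    where
    open ≡-Reasoning
    a = sum (map f L)
    b = sum (map g (filter S? L))
    c = sum (map g L)
    d = sum (map f (filter S? L))
    interchange : ∀ w x y z → w + x + (y + z) ≡ y + w + (x + z)
    interchange = solve-∀
    interchange′ : ∀ w x y z → w + x + (y + z) ≡ w + y + (x + z)
    interchange′ = solve-∀
  ... | no ¬s | ih = begin
    f u + a + b    ≡⟨ ℕ.+-assoc (f u) a b ⟩
    f u + (a + b)  ≡⟨ cong₂ _+_ (e (here refl) ¬s) ih ⟩
    g u + (c + d)  ≡⟨ ℕ.+-assoc (g u) c d ⟨
    g u + c + d    ∎
    where
    open ≡-Reasoning
    a = sum (map f L)
    b = sum (map g (filter S? L))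
    c = sum (map g L)
    d = sum (map f (filter S? L))

  module _ (chain : ℕ → Box) (on-chain : ∀ k → S (chain k)) (chain-covers : ∀ {u} → S u → ∃[ k ] u ≡ chain k)
    (chain-mono : ∀ k → chain k ⊑ chain (suc k)) (chain-injective : ∀ {k l} → chain k ≡ chain l → k ≡ l) where

    private
      chain-⊑ : ∀ {k l} → k ≤ l → chain k ⊑ chain l
      chain-⊑ {k} {l} k≤l with d , refl ← ℕ.m≤n⇒∃[o]m+o≡n k≤l = go d
        where
        go : ∀ d → chain k ⊑ chain (k + d)
        go zero    = subst (λ l → chain k ⊑ chain l) (sym (ℕ.+-identityʳ k)) (ℕ.≤-refl , ℕ.≤-refl)
        go (suc d) = subst (λ l → chain k ⊑ chain l) (sym (ℕ.+-suc k d)) (⊑-trans (go d) (chain-mono (k + d)))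

    -- The chain meets a diagram in an initial segment. If the latest box is `chain t`, it is the
    -- last term before `chain k`: a later term in the diagram would already lie in `L` and force
    -- `chain t ∈ L` by closure. Rows, columns and diagonals are the instances.
    chain-sum : ∀ {L} → Diagram L → ∀ f k → (∀ {t} → t < k → chain t ∈ L) → chain k ∉ L →
      sum (map f (filter S? L)) ≡ sumBelow k (f ∘ chain)
    chain-sum []                  f zero    _   _   = refl
    chain-sum []                  f (suc k) ∈L  _   with () ← ∈L (s≤s (z≤n {k}))
    chain-sum DL@(_∷_ {c} {L} add D) f k       ∈cL k∉cL with S? c
    ... | no ¬s = chain-sum D f k
      (λ {t} t<k → Any.tail (λ e → ¬s (subst S e (on-chain t))) (∈cL t<k)) (k∉cL ∘ there)
    ... | yes s with t , refl ← chain-covers s = last k ∈cL k∉cL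
      where
      last : ∀ k → (∀ {t′} → t′ < k → chain t′ ∈ (chain t ∷ L)) → chain k ∉ (chain t ∷ L) →
        f (chain t) + sum (map f (filter S? L)) ≡ sumBelow k (f ∘ chain)
      last k ∈cL k∉cL with k ℕ.≤? t
      last k       ∈cL k∉cL | yes k≤t = contradiction (⊑-closed DL (chain-⊑ k≤t) (here refl)) k∉cL
      last zero    ∈cL k∉cL | no  k≰t = contradiction z≤n k≰t
      last (suc k) ∈cL k∉cL | no  k≰t with ℕ.m≤n⇒m<n∨m≡n (ℕ.≰⇒> k≰t)
      ... | inj₂ refl      = cong (f (chain t) +_) (chain-sum D f t
        (λ t′<t → Any.tail (λ e → ℕ.<-irrefl (chain-injective e) t′<t) (∈cL (ℕ.m≤n⇒m≤1+n t′<t))) (proj₁ add))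
      ... | inj₁ (s≤s t<k) = contradiction (⊑-closed D (chain-⊑ (ℕ.<⇒≤ t<k))
        (Any.tail (λ e → ℕ.<-irrefl (sym (chain-injective e)) t<k) (∈cL ℕ.≤-refl))) (proj₁ add)

-- Like the row, column and rectangle sums below, this leaves out the given box, so that it can be
-- taken at a corner about to be added. The rectangle leaves out the whole row and column of the
-- box.
diagonalSum : (Box → ℕ) → Box → ℕ
diagonalSum f (zero  , j)     = 0
diagonalSum f (suc i , zero)  = 0
diagonalSum f (suc i , suc j) = f (i , j) + diagonalSum f (i , j)

rowSum columnSum rectangleSum : (Box → ℕ) → Box → ℕ
rowSum       f (i , j)     = sumBelow j (λ t → f (i , t))
columnSum    f (i , j)     = sumBelow i (λ t → f (t , j))
rectangleSum f (i , zero)  = 0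
rectangleSum f (i , suc j) = rectangleSum f (i , j) + columnSum f (i , j)

rectangleSum-suc : ∀ f i j → rectangleSum f (suc i , j) ≡ rectangleSum f (i , j) + rowSum f (i , j)
rectangleSum-suc f i zero    = refl
rectangleSum-suc f i (suc j) rewrite rectangleSum-suc f i j =
  rearrange (rectangleSum f (i , j)) (rowSum f (i , j)) (f (i , j)) (columnSum f (i , j))
  where
  rearrange : ∀ a b c d → a + b + (c + d) ≡ a + d + (c + b)
  rearrange = solve-∀

rectangleSum-zero : ∀ f j → rectangleSum f (0 , j) ≡ 0
rectangleSum-zero f zero    = refl
rectangleSum-zero f (suc j) = trans (ℕ.+-identityʳ _) (rectangleSum-zero f j)

diagonalSum-cong : ∀ {f g} i j → (∀ {u} → u ⊑ (i , j) → u ≢ (i , j) → f u ≡ g u) →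
  diagonalSum f (suc i , suc j) ≡ f (i , j) + diagonalSum g (i , j)
diagonalSum-cong {f} {g} i j e =
  cong (f (i , j) +_) (go i j λ p q → e (ℕ.<⇒≤ p , ℕ.<⇒≤ q) λ { refl → ℕ.<-irrefl refl p })
  where
  go : ∀ i j → (∀ {r s} → r < i → s < j → f (r , s) ≡ g (r , s)) → diagonalSum f (i , j) ≡ diagonalSum g (i , j)
  go zero    j       e = refl
  go (suc i) zero    e = refl
  go (suc i) (suc j) e = cong₂ _+_ (e (ℕ.n<1+n i) (ℕ.n<1+n j))
    (go i j λ p q → e (ℕ.m≤n⇒m≤1+n p) (ℕ.m≤n⇒m≤1+n q))

diagonalSum-zeroʳ : ∀ f i → diagonalSum f (i , 0) ≡ 0
diagonalSum-zeroʳ f zero    = refl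
diagonalSum-zeroʳ f (suc i) = refl

sumBelow-diagonal : ∀ f i j k → diagonalSum f (i , j) ≡ 0 →
  sumBelow k (λ t → f (i + t , j + t)) ≡ diagonalSum f (i + k , j + k)
sumBelow-diagonal f i j zero    e =
  sym (trans (cong₂ (λ a b → diagonalSum f (a , b)) (ℕ.+-identityʳ i) (ℕ.+-identityʳ j)) e)
sumBelow-diagonal f i j (suc k) e = trans (cong (f (i + k , j + k) +_) (sumBelow-diagonal f i j k e))
  (sym (cong₂ (λ a b → diagonalSum f (a , b)) (ℕ.+-suc i k) (ℕ.+-suc j k)))

module _ {c L} (add : Addable c L) (D : Diagram L) where

  private
    r = proj₁ c
    s = proj₂ c

  row-sum : ∀ f → sum (map f (filter (λ u → proj₁ u ℕ.≟ r) L)) ≡ rowSum f c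
  row-sum f = chain-sum (λ u → proj₁ u ℕ.≟ r) (r ,_) (λ _ → refl) (λ { {_ , j} refl → j , refl })
    (λ k → ℕ.≤-refl , ℕ.n≤1+n k) (λ { refl → refl }) D f s
    (λ t<s → proj₂ add (ℕ.≤-refl , ℕ.<⇒≤ t<s) λ { refl → ℕ.<-irrefl refl t<s }) (proj₁ add)

  column-sum : ∀ f → sum (map f (filter (λ u → proj₂ u ℕ.≟ s) L)) ≡ columnSum f c
  column-sum f = chain-sum (λ u → proj₂ u ℕ.≟ s) (_, s) (λ _ → refl) (λ { {i , _} refl → i , refl })
    (λ k → ℕ.n≤1+n k , ℕ.≤-refl) (λ { refl → refl }) D f r
    (λ t<r → proj₂ add (ℕ.<⇒≤ t<r , ℕ.≤-refl) λ { refl → ℕ.<-irrefl refl t<r }) (proj₁ add)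

diagonal-sum : ∀ {c L} → Addable c L → Diagram L → ∀ f →
  sum (map f (filter (onDiagonal? c) L)) ≡ diagonalSum f c
diagonal-sum {r , s} {L} add D f with ℕ.≤-total r s
-- The diagonal of `(r , s)` starts at `(0 , d)` on the top edge if `r ≤ s`, and at `(d , 0)` on the
-- left edge otherwise.
... | inj₁ r≤s with d , refl ← ℕ.m≤n⇒∃[o]m+o≡n r≤s = trans
  (chain-sum (onDiagonal? (r , r + d)) (λ t → t , d + t) (λ t → on t r d) covers
    (λ k → ℕ.n≤1+n k , ℕ.+-monoʳ-≤ d (ℕ.n≤1+n k)) (λ e → cong proj₁ e) D f r
    (λ {t} t<r → proj₂ add (ℕ.<⇒≤ t<r , subst (d + t ≤_) (ℕ.+-comm d r) (ℕ.+-monoʳ-≤ d (ℕ.<⇒≤ t<r)))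
      λ e → ℕ.<-irrefl (cong proj₁ e) t<r)
    (subst (λ x → (r , x) ∉ L) (ℕ.+-comm r d) (proj₁ add)))
  (trans (sumBelow-diagonal f 0 d r refl) (cong (λ x → diagonalSum f (r , x)) (ℕ.+-comm d r)))
  where
  on : ∀ t r d → t + (r + d) ≡ d + t + r
  on = solve-∀
  covers : ∀ {u} → OnDiagonal (r , r + d) u → ∃[ k ] u ≡ (k , d + k)
  covers {i , j} e = i , cong (i ,_) (ℕ.+-cancelʳ-≡ r j (d + i) (trans (sym e) (on i r d)))
... | inj₂ s≤r with d , refl ← ℕ.m≤n⇒∃[o]m+o≡n s≤r = trans
  (chain-sum (onDiagonal? (s + d , s)) (λ t → d + t , t) (λ t → on t s d) covers
    (λ k → ℕ.+-monoʳ-≤ d (ℕ.n≤1+n k) , ℕ.n≤1+n k) (λ e → cong proj₂ e) D f s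
    (λ {t} t<s → proj₂ add (subst (d + t ≤_) (ℕ.+-comm d s) (ℕ.+-monoʳ-≤ d (ℕ.<⇒≤ t<s)) , ℕ.<⇒≤ t<s)
      λ e → ℕ.<-irrefl (cong proj₂ e) t<s)
    (subst (λ x → (x , s) ∉ L) (ℕ.+-comm s d) (proj₁ add)))
  (trans (sumBelow-diagonal f d 0 s (diagonalSum-zeroʳ f d)) (cong (λ x → diagonalSum f (x , s)) (ℕ.+-comm d s)))
  where
  on : ∀ t s d → d + t + s ≡ t + (s + d)
  on = solve-∀
  covers : ∀ {u} → OnDiagonal (s + d , s) u → ∃[ k ] u ≡ (d + k , k)
  covers {i , j} e = j , cong (_, j) (ℕ.+-cancelʳ-≡ s i (d + j) (trans e (sym (on j s d))))

-- On the diagonal of c the new entries are max + min - old, and max + min is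
-- summed over the two neighbouring diagonals.
toggle-diagonalSum : ∀ {c L φ} → Addable c L → Diagram L → ReversePlanePartition L φ →
  ∀ i j → OnDiagonal c (i , j) → (i , j) ⊑ c →
  diagonalSum (toggle c φ) (i , j) + diagonalSum φ (i , j) + lower φ (i , j) ≡
  diagonalSum φ (suc i , j) + diagonalSum φ (i , suc j)
toggle-diagonalSum {φ = φ} add D rpp zero zero on le = refl
toggle-diagonalSum {φ = φ} add D rpp zero (suc j) on le = sym (trans (ℕ.+-identityʳ _) (ℕ.+-identityʳ _))
toggle-diagonalSum {φ = φ} add D rpp (suc i) zero on le = trans (ℕ.⊔-identityʳ _)
  (sym (trans (cong (φ (i , 0) +_) (diagonalSum-zeroʳ φ i)) (ℕ.+-identityʳ _)))
toggle-diagonalSum {c} {L} {φ} add D rpp (suc i) (suc j) on (i<r , j<s) = begin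
  τ + Δ′ + (p + Δ) + (d ⊔ e)           ≡⟨ r₁ τ Δ′ p Δ (d ⊔ e) ⟩
  (τ + p) + (Δ′ + Δ) + (d ⊔ e)         ≡⟨ cong (λ x → x + (Δ′ + Δ) + (d ⊔ e)) τ+p ⟩
  (l + (e ⊓ d)) + (Δ′ + Δ) + (d ⊔ e)   ≡⟨ r₂ l (e ⊓ d) (Δ′ + Δ) (d ⊔ e) ⟩
  ((e ⊓ d) + (d ⊔ e)) + (Δ′ + Δ + l)
    -- The boxes below and right of `(i , j)` are the boxes left of and above `(suc i , suc j)`, so
    -- the minimum from the toggle at the former meets the maximum left over at the latter.
    ≡⟨ cong₂ _+_ (⊓+⊔ e d) (toggle-diagonalSum add D rpp i j on′ (ℕ.<⇒≤ i<r , ℕ.<⇒≤ j<s)) ⟩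
  (e + d) + (Δ₁ + Δ₂)                  ≡⟨ r₃ e d Δ₁ Δ₂ ⟩
  e + Δ₁ + (d + Δ₂)                    ∎
  where
  open ≡-Reasoning
  τ = toggle c φ (i , j)
  Δ′ = diagonalSum (toggle c φ) (i , j)
  Δ = diagonalSum φ (i , j)
  p = φ (i , j)
  l = lower φ (i , j)
  d = φ (i , suc j)
  e = φ (suc i , j)
  Δ₁ = diagonalSum φ (suc i , j)
  Δ₂ = diagonalSum φ (i , suc j)
  r₁ : ∀ a b c d e → a + b + (c + d) + e ≡ a + c + (b + d) + e
  r₁ = solve-∀
  r₂ : ∀ a b c d → a + b + c + d ≡ b + d + (c + a)
  r₂ = solve-∀
  r₃ : ∀ a b c d → a + b + (c + d) ≡ a + c + (b + d)
  r₃ = solve-∀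
  ⊓+⊔ : ∀ m n → (m ⊓ n) + (n ⊔ m) ≡ m + n
  ⊓+⊔ m n with ℕ.≤-total m n
  ... | inj₁ m≤n = cong₂ _+_ (ℕ.m≤n⇒m⊓n≡m m≤n) (ℕ.m≥n⇒m⊔n≡m m≤n)
  ... | inj₂ n≤m = trans (cong₂ _+_ (ℕ.m≥n⇒m⊓n≡n n≤m) (ℕ.m≤n⇒m⊔n≡n n≤m)) (ℕ.+-comm n m)
  on′ : OnDiagonal c (i , j)
  on′ = ℕ.suc-injective on
  u∈L : (i , j) ∈ L
  u∈L = proj₂ add (ℕ.<⇒≤ i<r , ℕ.<⇒≤ j<s) λ { refl → ℕ.<-irrefl refl i<r }
  τ+p : τ + p ≡ l + (e ⊓ d)
  τ+p = trans (cong (_+ p) (toggle-on {c} {i , j} φ on′))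
    (ℕ.m∸n+n≡m (ℕ.≤-trans (≤-upper add D rpp u∈L on′) (ℕ.m≤n+m (e ⊓ d) l)))

-- Boxes just outside the diagram at the end of their diagonal.
Rim : List Box → Box → Set
Rim L (i , j) = (i , j) ∉ L × (i ≡ 0 ⊎ j ≡ 0 ⊎ (ℕ.pred i , ℕ.pred j) ∈ L)

addable-rim : ∀ {c L} → Addable c L → Rim L c
addable-rim {zero  , s}     add = proj₁ add , inj₁ refl
addable-rim {suc r , zero}  add = proj₁ add , inj₂ (inj₁ refl)
addable-rim {suc r , suc s} add =
  proj₁ add , inj₂ (inj₂ (proj₂ add (ℕ.n≤1+n r , ℕ.n≤1+n s) λ ()))

-- A new corner alters its own diagonal only, so a rim box of another diagonal inherits the
-- equation. The rim box just past the corner is the case `extend-diagonalSum`, which calls this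
-- lemma for the smaller diagram at the corner and at the boxes below it and to its right. On the
-- top and left edges both sums are empty.
diagonalSum-rim : ∀ {L} → Diagram L → ∀ A {u} → Rim L u →
  diagonalSum (fromMultiplicities L A) u ≡ rectangleSum A u

-- By inclusion-exclusion the rectangle sums at `(suc r , suc s)` and at `c` add up to `A c` plus
-- those at `(suc r , s)` and `(r , suc s)`. With the new entry `A c + lower φ c`,
-- `toggle-diagonalSum` gives the diagonal sums the same relation. Adding `Δ` to both sides avoids a
-- subtraction.
extend-diagonalSum : ∀ {c L} → Addable c L → Diagram L → ∀ A →
  diagonalSum (fromMultiplicities (c ∷ L) A) (suc (proj₁ c) , suc (proj₂ c)) ≡
  rectangleSum A (suc (proj₁ c) , suc (proj₂ c))
extend-diagonalSum {c@(r , s)} {L} add D A = ℕ.+-cancelʳ-≡ Δ _ _ (begin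
  diagonalSum φ′ (suc r , suc s) + Δ
    ≡⟨ cong (_+ Δ) (diagonalSum-cong {φ′} {toggle c φ} r s λ u⊑c u≢c → extend-≢ (A c) φ u≢c) ⟩
  φ′ c + diagonalSum (toggle c φ) c + Δ
    ≡⟨ cong (λ x → x + diagonalSum (toggle c φ) c + Δ) (extend-≡ c (A c) φ) ⟩
  A c + lower φ c + diagonalSum (toggle c φ) c + Δ
    ≡⟨ r₁ (A c) (lower φ c) (diagonalSum (toggle c φ) c) Δ ⟩
  A c + (diagonalSum (toggle c φ) c + Δ + lower φ c)
    ≡⟨ cong (A c +_)
         (toggle-diagonalSum add D (fromMultiplicities-rpp D A) r s (on-c add D) (ℕ.≤-refl , ℕ.≤-refl)) ⟩
  A c + (diagonalSum φ (suc r , s) + diagonalSum φ (r , suc s))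
    ≡⟨ cong (A c +_) (cong₂ _+_ (diagonalSum-rim D A (down add)) (diagonalSum-rim D A (right add))) ⟩
  A c + (rectangleSum A (suc r , s) + rectangleSum A (r , suc s))
    ≡⟨ cong (λ x → A c + (x + rectangleSum A (r , suc s))) (rectangleSum-suc A r s) ⟩
  A c + (rectangleSum A c + rowSum A c + (rectangleSum A c + columnSum A c))
    ≡⟨ r₂ (A c) (rectangleSum A c) (rowSum A c) (columnSum A c) ⟩
  rectangleSum A c + rowSum A c + (A c + columnSum A c) + rectangleSum A c
    ≡⟨ cong₂ (λ x y → x + (A c + columnSum A c) + y) (sym (rectangleSum-suc A r s)) (sym Δ≡) ⟩
  rectangleSum A (suc r , suc s) + Δ  ∎)
  where
  open ≡-Reasoning
  φ = fromMultiplicities L A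
  φ′ = fromMultiplicities (c ∷ L) A
  Δ = diagonalSum φ c
  r₁ : ∀ a b c d → a + b + c + d ≡ a + (c + d + b)
  r₁ = solve-∀
  r₂ : ∀ a b c d → a + (b + c + (b + d)) ≡ b + c + (a + d) + b
  r₂ = solve-∀
  down : ∀ {r s} → Addable (r , s) L → Rim L (suc r , s)
  down {r} {zero}  add = (λ ∈L → proj₁ add (⊑-closed D (ℕ.n≤1+n r , ℕ.≤-refl) ∈L)) , inj₂ (inj₁ refl)
  down {r} {suc s} add = (λ ∈L → proj₁ add (⊑-closed D (ℕ.n≤1+n r , ℕ.≤-refl) ∈L)) ,
    inj₂ (inj₂ (proj₂ add (ℕ.≤-refl , ℕ.n≤1+n s) λ ()))
  right : ∀ {r s} → Addable (r , s) L → Rim L (r , suc s)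
  right {zero}  {s} add = (λ ∈L → proj₁ add (⊑-closed D (ℕ.≤-refl , ℕ.n≤1+n s) ∈L)) , inj₁ refl
  right {suc r} {s} add = (λ ∈L → proj₁ add (⊑-closed D (ℕ.≤-refl , ℕ.n≤1+n s) ∈L)) ,
    inj₂ (inj₂ (proj₂ add (ℕ.n≤1+n r , ℕ.≤-refl) λ ()))
  Δ≡ : Δ ≡ rectangleSum A c
  Δ≡ = diagonalSum-rim D A (addable-rim add)

diagonalSum-rim {[]}    D         A {zero , j}      _ = sym (rectangleSum-zero A j)
diagonalSum-rim {[]}    D         A {suc i , zero}  _ = refl
diagonalSum-rim {[]}    D         A {suc i , suc j} (_ , inj₂ (inj₂ ()))
diagonalSum-rim {c ∷ L} (add ∷ D) A {zero , j}      _ = sym (rectangleSum-zero A j)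
diagonalSum-rim {c ∷ L} (add ∷ D) A {suc i , zero}  _ = refl
diagonalSum-rim {c ∷ L} (add ∷ D) A {suc i , suc j} (u∉cL , inj₂ (inj₂ (here refl))) = extend-diagonalSum add D A
diagonalSum-rim {c@(r , s) ∷ L} (add ∷ D) A {suc i , suc j} (u∉cL , inj₂ (inj₂ (there ∈L))) = trans
  (off (suc i) (suc j) λ on → let p , q = diagonal-< add D ∈L (ℕ.suc-injective on) in
    u∉cL (⊑-closed (add ∷ D) (p , q) (here refl)))
  (diagonalSum-rim D A (u∉cL ∘ there , inj₂ (inj₂ ∈L)))
  where
  φ = fromMultiplicities L A
  off : ∀ i j → ¬ OnDiagonal c (i , j) → diagonalSum (extend c (A c) φ) (i , j) ≡ diagonalSum φ (i , j)
  off zero    j       ¬on = refl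
  off (suc i) zero    ¬on = refl
  off (suc i) (suc j) ¬on = cong₂ _+_ (extend-off {c} {i , j} (A c) φ (¬on ∘ cong suc)) (off i j (¬on ∘ cong suc))

extend-sum : ∀ {c L} → Addable c L → Diagram L → ∀ A →
  sum (map (fromMultiplicities (c ∷ L) A) (c ∷ L)) ≡
  sum (map (fromMultiplicities L A) L) + (A c + (rowSum A c + columnSum A c))
extend-sum {c@(r , s)} {L} add D A = ℕ.+-cancelʳ-≡ X _ _ (ℕ.+-cancelʳ-≡ X _ _ (begin
  φ′ c + σ′ + X + X
    ≡⟨ cong (λ x → φ′ c + σ′ + x + X) X≡ ⟨
  φ′ c + σ′ + diagonalSum φ c + X
    ≡⟨ cong (_+ X) (ℕ.+-assoc (φ′ c) σ′ (diagonalSum φ c)) ⟩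
  φ′ c + (σ′ + diagonalSum φ c) + X
    ≡⟨ cong (λ x → φ′ c + x + X) off ⟩
  φ′ c + (σ + diagonalSum φ′ c) + X
    ≡⟨ r₁ (φ′ c) σ (diagonalSum φ′ c) X ⟩
  σ + (φ′ c + diagonalSum φ′ c) + X
    ≡⟨ cong (λ x → σ + x + X) (extend-diagonalSum add D A) ⟩
  σ + rectangleSum A (suc r , suc s) + X
    ≡⟨ cong (λ x → σ + (x + (A c + columnSum A c)) + X) (rectangleSum-suc A r s) ⟩
  σ + (X + rowSum A c + (A c + columnSum A c)) + X
    ≡⟨ r₂ σ X (rowSum A c) (A c) (columnSum A c) ⟩
  σ + (A c + (rowSum A c + columnSum A c)) + X + X  ∎))
  where
  open ≡-Reasoning
  φ = fromMultiplicities L A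
  φ′ = fromMultiplicities (c ∷ L) A
  σ = sum (map φ L)
  σ′ = sum (map φ′ L)
  X = rectangleSum A c
  X≡ : diagonalSum φ c ≡ X
  X≡ = diagonalSum-rim D A (addable-rim add)
  off : σ′ + diagonalSum φ c ≡ σ + diagonalSum φ′ c
  off = begin
    σ′ + diagonalSum φ c                             ≡⟨ cong (σ′ +_) (diagonal-sum add D φ) ⟨
    σ′ + sum (map φ (filter (onDiagonal? c) L
         ))      ≡⟨ sum-off-filter (onDiagonal? c) L (λ {u} _ → extend-off {c} {u} (A c) φ) ⟩
    σ + sum (map φ′ (filter (onDiagonal? c) L))      ≡⟨ cong (σ +_) (diagonal-sum add D φ′) ⟩
    σ + diagonalSum φ′ c                             ∎
  r₁ : ∀ a b c d → a + (b + c) + d ≡ b + (a + c) + d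
  r₁ = solve-∀
  r₂ : ∀ a b c d e → a + (b + c + (d + e)) + b ≡ a + (d + (c + e)) + b + b
  r₂ = solve-∀

-- Hook lengths in a growing diagram

HookBox : Box → Box → Set
HookBox (i , j) (i′ , j′) = (i′ ≡ i × j ≤ j′) ⊎ (j′ ≡ j × i < i′)

hookBox? : ∀ u → Decidable (HookBox u)
hookBox? (i , j) (i′ , j′) = ((i′ ℕ.≟ i) ×-dec (j ℕ.≤? j′)) ⊎-dec ((j′ ℕ.≟ j) ×-dec (i ℕ.<? i′))

hook : List Box → Box → ℕ
hook L u = length (filter (hookBox? u) L)

hook-accept : ∀ {u c} L → HookBox u c → hook (c ∷ L) u ≡ suc (hook L u)
hook-accept {u} L h = cong length (List.filter-accept (hookBox? u) {xs = L} h)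

hook-reject : ∀ {u c} L → ¬ HookBox u c → hook (c ∷ L) u ≡ hook L u
hook-reject {u} L ¬h = cong length (List.filter-reject (hookBox? u) {xs = L} ¬h)

hook-addable : ∀ {c L} → Addable c L → Diagram L → hook (c ∷ L) c ≡ 1
hook-addable {c} {L} add D = trans (hook-accept {c} L (inj₁ (refl , ℕ.≤-refl)))
  (cong (suc ∘ length) (List.filter-none (hookBox? c) (All.tabulate λ u∈L h →
    proj₁ add (⊑-closed D (c⊑ h) u∈L))))
  where
  c⊑ : ∀ {u} → HookBox c u → c ⊑ u
  c⊑ (inj₁ (refl , le)) = ℕ.≤-refl , le
  c⊑ (inj₂ (refl , lt)) = ℕ.<⇒≤ lt , ℕ.≤-refl

-- No box of `L` dominates `c`, so `c` joins the hook of `u` exactly when `u` shares its row or its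
-- column, and not both as `c ∉ L`. The sum runs over a separate list `M` inside `L`, so that the
-- hooks stay those of `L` while the induction shortens `M`.
hook-sum-∷ : ∀ {c L} → Addable c L → Diagram L → ∀ A {M} → (∀ {u} → u ∈ M → u ∈ L) →
  sum (map (λ u → hook (c ∷ L) u * A u) M) ≡
  sum (map (λ u → hook L u * A u) M) +
  (sum (map A (filter (λ u → proj₁ u ℕ.≟ proj₁ c) M)) + sum (map A (filter (λ u → proj₂ u ℕ.≟ proj₂ c) M)))
hook-sum-∷ add D A {[]} M⊆L = refl
hook-sum-∷ {c@(r , s)} {L} add D A {u@(i , j) ∷ M} M⊆L = go (i ℕ.≟ r) (j ℕ.≟ s)
  where
  open ≡-Reasoning
  row = λ M → sum (map A (filter (λ u → proj₁ u ℕ.≟ r) M))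
  col = λ M → sum (map A (filter (λ u → proj₂ u ℕ.≟ s) M))
  row-accept : i ≡ r → row (u ∷ M) ≡ A u + row M
  row-accept e = cong (sum ∘ map A) (List.filter-accept (λ u → proj₁ u ℕ.≟ r) e)
  row-reject : i ≢ r → row (u ∷ M) ≡ row M
  row-reject e = cong (sum ∘ map A) (List.filter-reject (λ u → proj₁ u ℕ.≟ r) e)
  col-accept : j ≡ s → col (u ∷ M) ≡ A u + col M
  col-accept e = cong (sum ∘ map A) (List.filter-accept (λ u → proj₂ u ℕ.≟ s) e)
  col-reject : j ≢ s → col (u ∷ M) ≡ col M
  col-reject e = cong (sum ∘ map A) (List.filter-reject (λ u → proj₂ u ℕ.≟ s) e)
  a = hook L u * A u
  h′ = sum (map (λ u → hook (c ∷ L) u * A u) M)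
  h = sum (map (λ u → hook L u * A u) M)
  ih : h′ ≡ h + (row M + col M)
  ih = hook-sum-∷ add D A (M⊆L ∘ there)
  r₁ : ∀ a x b c d → a + x + (b + (c + d)) ≡ x + b + (a + c + d)
  r₁ = solve-∀
  r₂ : ∀ a x b c d → a + x + (b + (c + d)) ≡ x + b + (c + (a + d))
  r₂ = solve-∀
  go : Dec (i ≡ r) → Dec (j ≡ s) → hook (c ∷ L) u * A u + h′ ≡ a + h + (row (u ∷ M) + col (u ∷ M))
  go (yes refl) (yes refl) = contradiction (M⊆L (here refl)) (proj₁ add)
  go (yes refl) (no ¬q) = begin
    hook (c ∷ L) u * A u + h′
      ≡⟨ cong₂ (λ x y → x * A u + y) (hook-accept {u} {c} L (inj₁ (refl , j≤s))) ih ⟩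
    A u + a + (h + (row M + col M))      ≡⟨ r₁ (A u) a h (row M) (col M) ⟩
    a + h + (A u + row M + col M)        ≡⟨ cong₂ (λ x y → a + h + (x + y)) (row-accept refl) (col-reject ¬q) ⟨
    a + h + (row (u ∷ M) + col (u ∷ M))  ∎
    where
    j≤s : j ≤ s
    j≤s = ℕ.≮⇒≥ λ s<j → proj₁ add (⊑-closed D (ℕ.≤-refl , ℕ.<⇒≤ s<j) (M⊆L (here refl)))
  go (no ¬p) (yes refl) = begin
    hook (c ∷ L) u * A u + h′
      ≡⟨ cong₂ (λ x y → x * A u + y) (hook-accept {u} {c} L (inj₂ (refl , i<r))) ih ⟩
    A u + a + (h + (row M + col M))      ≡⟨ r₂ (A u) a h (row M) (col M) ⟩
    a + h + (row M + (A u + col M))      ≡⟨ cong₂ (λ x y → a + h + (x + y)) (row-reject ¬p) (col-accept refl) ⟨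
    a + h + (row (u ∷ M) + col (u ∷ M))  ∎
    where
    i<r : i < r
    i<r = ℕ.≰⇒> λ r≤i → proj₁ add (⊑-closed D (r≤i , ℕ.≤-refl) (M⊆L (here refl)))
  go (no ¬p) (no ¬q) = begin
    hook (c ∷ L) u * A u + h′
      ≡⟨ cong₂ (λ x y → x * A u + y)
         (hook-reject {u} {c} L λ { (inj₁ (e , _)) → ¬p (sym e) ; (inj₂ (e , _)) → ¬q (sym e) }) ih ⟩
    a + (h + (row M + col M))            ≡⟨ ℕ.+-assoc a h _ ⟨
    a + h + (row M + col M)              ≡⟨ cong₂ (λ x y → a + h + (x + y)) (row-reject ¬p) (col-reject ¬q) ⟨
    a + h + (row (u ∷ M) + col (u ∷ M))  ∎

fromMultiplicities-sum : ∀ {L} → Diagram L → ∀ A →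
  sum (map (fromMultiplicities L A) L) ≡ sum (map (λ u → hook L u * A u) L)
fromMultiplicities-sum []                  A = refl
fromMultiplicities-sum (_∷_ {c} {L} add D) A = begin
  sum (map (fromMultiplicities (c ∷ L) A) (c ∷ L))
    ≡⟨ extend-sum add D A ⟩
  sum (map (fromMultiplicities L A) L) + (A c + (rowSum A c + columnSum A c))
    ≡⟨ cong₂ (λ x y → x + (A c + y)) (fromMultiplicities-sum D A)
         (cong₂ _+_ (sym (row-sum add D A)) (sym (column-sum add D A))) ⟩
  h + (A c + l)
    ≡⟨ rearrange h (A c) l ⟩
  1 * A c + (h + l)
    ≡⟨ cong₂ (λ x y → x * A c + y) (hook-addable add D) (hook-sum-∷ add D A id) ⟨
  sum (map (λ u → hook (c ∷ L) u * A u) (c ∷ L))  ∎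
  where
  open ≡-Reasoning
  h = sum (map (λ u → hook L u * A u) L)
  l = sum (map A (filter (λ u → proj₁ u ℕ.≟ proj₁ c) L)) + sum (map A (filter (λ u → proj₂ u ℕ.≟ proj₂ c) L))
  rearrange : ∀ a b c → a + (b + c) ≡ 1 * b + (a + c)
  rearrange = solve-∀

-- Lists

unique-↭ : {A : Set} {xs ys : List A} → Unique xs → Unique ys → (∀ {x} → x ∈ xs ⇔ x ∈ ys) → xs ↭ ys
unique-↭ xs! ys! e = ∼bag⇒↭ (unique∧set⇒bag xs! ys! e)

sum-map-↭ : {A : Set} (f : A → ℕ) {xs ys : List A} → xs ↭ ys → sum (map f xs) ≡ sum (map f ys)
sum-map-↭ f p = sum-↭ (↭.map⁺ f p)

sum-map-+ : {A : Set} (f g : A → ℕ) (xs : List A) →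
  sum (map (λ x → f x + g x) xs) ≡ sum (map f xs) + sum (map g xs)
sum-map-+ f g []       = refl
sum-map-+ f g (x ∷ xs) rewrite sum-map-+ f g xs = rearrange (f x) (g x) (sum (map f xs)) (sum (map g xs))
  where
  rearrange : ∀ a b c d → a + b + (c + d) ≡ a + c + (b + d)
  rearrange = solve-∀

module _ {A : Set} {P Q : Pred A 0ℓ} (P? : Decidable P) (Q? : Decidable Q) where

  length-filter-cong : ∀ xs → (∀ {x} → x ∈ xs → P x ⇔ Q x) → length (filter P? xs) ≡ length (filter Q? xs)
  length-filter-cong []       e = refl
  length-filter-cong (x ∷ xs) e with P? x | Q? x | length-filter-cong xs (e ∘ there)
  ... | yes p | yes q | ih = cong suc ih
  ... | yes p | no ¬q | _  = contradiction (to (e (here refl)) p) ¬q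
  ... | no ¬p | yes q | _  = contradiction (from (e (here refl)) q) ¬p
  ... | no ¬p | no ¬q | ih = ih

  length-filter-≤ : ∀ xs → (∀ {x} → P x → Q x) → length (filter P? xs) ≤ length (filter Q? xs)
  length-filter-≤ []       i = z≤n
  length-filter-≤ (x ∷ xs) i with P? x | Q? x | length-filter-≤ xs i
  ... | yes p | yes q | ih = s≤s ih
  ... | yes p | no ¬q | _  = contradiction (i p) ¬q
  ... | no ¬p | yes q | ih = ℕ.m≤n⇒m≤1+n ih
  ... | no ¬p | no ¬q | ih = ih

  length-filter-< : ∀ {x xs} → x ∈ xs → ¬ P x → Q x → (∀ {x} → P x → Q x) →
    length (filter P? xs) < length (filter Q? xs)
  length-filter-< {x} {x ∷ xs} (here refl) ¬p q i with P? x | Q? x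
  ... | yes p | _     = contradiction p ¬p
  ... | _     | no ¬q = contradiction q ¬q
  ... | no _  | yes _ = s≤s (length-filter-≤ xs i)
  length-filter-< {x} {y ∷ xs} (there x∈xs) ¬p q i with P? y | Q? y | length-filter-< x∈xs ¬p q i
  ... | yes p | yes q | ih = s≤s ih
  ... | yes p | no ¬q | _  = contradiction (i p) ¬q
  ... | no ¬p | yes q | ih = ℕ.m≤n⇒m≤1+n ih
  ... | no ¬p | no ¬q | ih = ih

module _ {A : Set} {P Q : Pred A 0ℓ} (P? : Decidable P) (Q? : Decidable Q) where

  length-filter-suc : ∀ {x xs} → Unique xs → x ∈ xs → P x → ¬ Q x → (∀ {y} → y ≢ x → P y ⇔ Q y) →
    length (filter P? xs) ≡ suc (length (filter Q? xs))
  length-filter-suc {x} {x ∷ xs} (x∉xs ∷ _) (here refl) p ¬q e with P? x | Q? x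
  ... | no ¬p | _     = contradiction p ¬p
  ... | _     | yes q = contradiction q ¬q
  ... | yes _ | no _  = cong suc (length-filter-cong P? Q? xs λ y∈xs → e (≢-sym (All.lookup x∉xs y∈xs)))
  length-filter-suc {x} {y ∷ xs} (y∉xs ∷ xs!) (there x∈xs) p ¬q e
    with P? y | Q? y | length-filter-suc xs! x∈xs p ¬q e
  ... | yes _ | yes _ | ih = cong suc ih
  ... | yes p | no ¬q | _  = contradiction (to (e (All.lookup y∉xs x∈xs)) p) ¬q
  ... | no ¬p | yes q | _  = contradiction (from (e (All.lookup y∉xs x∈xs)) q) ¬p
  ... | no _  | no _  | ih = ih

length-filter-map : ∀ {A B : Set} {P : Pred B 0ℓ} {Q : Pred A 0ℓ} {f : A → B}
  (P? : Decidable P) (Q? : Decidable Q) → (∀ x → P (f x) ⇔ Q x) →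
  ∀ xs → length (filter P? (map f xs)) ≡ length (filter Q? xs)
length-filter-map P? Q? e [] = refl
length-filter-map {f = f} P? Q? e (x ∷ xs) with P? (f x) | Q? x | length-filter-map P? Q? e xs
... | yes p | yes q | ih = cong suc ih
... | yes p | no ¬q | _  = contradiction (to (e x) p) ¬q
... | no ¬p | yes q | _  = contradiction (from (e x) q) ¬p
... | no ¬p | no ¬q | ih = ih

injective⇒strictlySurjective : ∀ {n} {f : Fin n → Fin n} → Injective _≡_ _≡_ f → StrictlySurjective _≡_ f
injective⇒strictlySurjective {suc n} {f} inj k with Fin.any? (λ i → f i Fin.≟ k)
... | yes hit = hit
... | no miss = contradiction
  (Fin.injective⇒≤ {f = λ i → punchOut (miss′ i)}
    λ {i} {j} e → inj (Fin.punchOut-injective (miss′ i) (miss′ j) e))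
  ℕ.1+n≰n
  where
  miss′ : ∀ i → k ≢ f i
  miss′ i e = miss (i , sym e)

-- Weakly increasing sequences: dᵢ is added to the last i + 1 of the n terms.

fromSteps : ℕ → (ℕ → ℕ) → ℕ → ℕ
fromSteps zero    d k       = 0
fromSteps (suc n) d zero    = d n
fromSteps (suc n) d (suc k) = d n + fromSteps n d k

fromSteps-cong : ∀ n {d e} → (∀ {i} → i < n → d i ≡ e i) → ∀ k → fromSteps n d k ≡ fromSteps n e k
fromSteps-cong zero    p k       = refl
fromSteps-cong (suc n) p zero    = p ℕ.≤-refl
fromSteps-cong (suc n) p (suc k) = cong₂ _+_ (p ℕ.≤-refl) (fromSteps-cong n (p ∘ ℕ.m≤n⇒m≤1+n) k)

-- The bound matters: from index `n` on, `fromSteps n d` falls back to 0.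
fromSteps-step : ∀ n d k → suc k < n → fromSteps n d k ≤ fromSteps n d (suc k)
fromSteps-step (suc n) d zero    _         = ℕ.m≤m+n (d n) _
fromSteps-step (suc n) d (suc k) (s≤s k<n) = ℕ.+-monoʳ-≤ (d n) (fromSteps-step n d k k<n)

fromSteps-injective : ∀ n {d e} → (∀ (k : Fin n) → fromSteps n d (toℕ k) ≡ fromSteps n e (toℕ k)) →
  ∀ {i} → i < n → d i ≡ e i
fromSteps-injective (suc n) {d} {e} p {i} (s≤s i≤n) with ℕ.m≤n⇒m<n∨m≡n i≤n
... | inj₂ refl = p zero
... | inj₁ i<n  = fromSteps-injective n
  (λ k → ℕ.+-cancelˡ-≡ (d n) _ _ (trans (p (suc k)) (cong (_+ fromSteps n e (toℕ k)) (sym (p zero))))) i<n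

-- The step with index `n` is common to all `suc n` terms, so it has to be the first term; what
-- remains after subtracting it is again weakly increasing.
fromSteps-surjective : ∀ n (g : Fin n → ℕ) → (∀ {i j} → i Fin.≤ j → g i ≤ g j) →
  ∃[ d ] (∀ k → fromSteps n d (toℕ k) ≡ g k)
fromSteps-surjective zero    g mono = (λ _ → 0) , λ ()
fromSteps-surjective (suc n) g mono
  with d , p ← fromSteps-surjective n (λ k → g (suc k) ∸ g zero)
    (λ le → ℕ.∸-monoˡ-≤ (g zero) (mono (s≤s le))) =
  d′ , λ
  { zero    → d′n
  ; (suc k) → begin
    d′ n + fromSteps n d′ (toℕ k)
      ≡⟨ cong₂ _+_ d′n (fromSteps-cong n (λ i<n → insert-≢ ℕ._≟_ suc (g zero) d (ℕ.>⇒≢ i<n)) (toℕ k)) ⟩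
    g zero + fromSteps n d (toℕ k)  ≡⟨ cong (g zero +_) (p k) ⟩
    g zero + (g (suc k) ∸ g zero)   ≡⟨ ℕ.m+[n∸m]≡n (mono z≤n) ⟩
    g (suc k)                       ∎
  }
  where
  open ≡-Reasoning
  d′ = insert ℕ._≟_ suc n (g zero) d
  d′n : d′ n ≡ g zero
  d′n = insert-≡ ℕ._≟_ suc n (g zero) d

sum-tabulate-+ : ∀ n c (f : Fin n → ℕ) → sum (tabulate (λ k → c + f k)) ≡ n * c + sum (tabulate f)
sum-tabulate-+ zero    c f = refl
sum-tabulate-+ (suc n) c f rewrite sum-tabulate-+ n c (f ∘ suc) =
  rearrange c (f zero) (n * c) (sum (tabulate (f ∘ suc)))
  where
  rearrange : ∀ a b c d → a + b + (c + d) ≡ a + c + (b + d)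
  rearrange = solve-∀

fromSteps-sum : ∀ n d → sum (tabulate {n = n} (fromSteps n d ∘ toℕ)) ≡ total-weight suc (upTo n) d
fromSteps-sum zero    d = refl
fromSteps-sum (suc n) d = begin
  d n + sum (tabulate {n = n} (λ k → d n + fromSteps n d (toℕ k)))
    ≡⟨ cong (d n +_) (sum-tabulate-+ n (d n) (fromSteps n d ∘ toℕ)) ⟩
  d n + (n * d n + sum (tabulate {n = n} (fromSteps n d ∘ toℕ)))
    ≡⟨ cong (λ x → d n + (n * d n + x)) (fromSteps-sum n d) ⟩
  d n + (n * d n + total-weight suc (upTo n) d)
    ≡⟨ rearrange (d n) (n * d n) (total-weight suc (upTo n) d) ⟩
  total-weight suc (upTo n) d + (suc n * d n + 0)
    ≡⟨ sum-++ (map (λ i → suc i * d i) (upTo n)) (suc n * d n ∷ []) ⟨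
  sum (map (λ i → suc i * d i) (upTo n) ++ suc n * d n ∷ [])
    ≡⟨ cong sum (List.map-++ (λ i → suc i * d i) (upTo n) (n ∷ [])) ⟨
  sum (map (λ i → suc i * d i) (upTo n ∷ʳ n))
    ≡⟨ cong (total-weightˢ) (List.upTo-∷ʳ n) ⟩
  total-weight suc (upTo (suc n)) d  ∎
  where
  open ≡-Reasoning
  total-weightˢ = λ is → total-weight suc is d
  rearrange : ∀ a b c → a + (b + c) ≡ c + (a + b + 0)
  rearrange = solve-∀

-- Young diagrams

lookup-antitone : ∀ {xs} → Linked ℕ._≥_ xs → ∀ i j → toℕ i ≤ toℕ j → lookup xs j ≤ lookup xs i
lookup-antitone {xs} dec i j i≤j = go (Linked⇒AllPairs (λ p q → ℕ.≤-trans q p) dec) i j i≤j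
  where
  go : ∀ {xs} → AllPairs ℕ._≥_ xs → ∀ i j → toℕ i ≤ toℕ j → lookup xs j ≤ lookup xs i
  go (ps ∷ _)  zero    zero    _         = ℕ.≤-refl
  go (ps ∷ _)  zero    (suc j) _         = All.lookup ps (∈-lookup j)
  go (_ ∷ pps) (suc i) (suc j) (s≤s i≤j) = go pps i j i≤j

module _ {n} (μ : Partition n) where

  box : Node μ → Box
  box (i , j) = toℕ i , toℕ j

  box-injective : ∀ {α β} → box α ≡ box β → α ≡ β
  box-injective {i , j} {i′ , j′} e with refl ← Fin.toℕ-injective (cong proj₁ e) =
    cong (i ,_) (Fin.toℕ-injective (cong proj₂ e))

  box? : ∀ u → Dec (∃[ α ] box α ≡ u)
  box? (i , j) with i ℕ.<? length (parts μ)
  ... | no i≮ = no λ { ((i′ , _) , refl) → i≮ (Fin.toℕ<n i′) }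
  ... | yes i< with j ℕ.<? lookup (parts μ) (fromℕ< i<)
  ...   | yes j< = yes ((fromℕ< i< , fromℕ< j<) , cong₂ _,_ (Fin.toℕ-fromℕ< i<) (Fin.toℕ-fromℕ< j<))
  ...   | no j≮  = no λ { ((i′ , j′) , refl) →
    j≮ (subst (λ k → toℕ j′ < lookup (parts μ) k) (sym (Fin.fromℕ<-toℕ i′ i<)) (Fin.toℕ<n j′)) }

  box-closed : ∀ {u} β → u ⊑ box β → ∃[ α ] box α ≡ u
  box-closed {i , j} (i′ , j′) (i≤ , j≤) =
    (fromℕ< i< , fromℕ< j<) , cong₂ _,_ (Fin.toℕ-fromℕ< i<) (Fin.toℕ-fromℕ< j<)
    where
    i< : i < length (parts μ)
    i< = ℕ.≤-<-trans i≤ (Fin.toℕ<n i′)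
    j< : j < lookup (parts μ) (fromℕ< i<)
    j< = ℕ.<-≤-trans (ℕ.≤-<-trans j≤ (Fin.toℕ<n j′))
      (lookup-antitone (decreasing μ) (fromℕ< i<) i′ (subst (_≤ toℕ i′) (sym (Fin.toℕ-fromℕ< i<)) i≤))

  nodes-unique : Unique (nodes μ)
  nodes-unique = Unique.concat⁺
    (All.map⁺ (All.universal (λ i → Unique.map⁺ (λ { refl → refl }) (Unique.allFin⁺ _)) _))
    (AllPairs.map⁺ (AllPairs.map disjoint (Unique.allFin⁺ (length (parts μ)))))
    where
    disjoint : ∀ {i i′} → i ≢ i′ → ∀ {α} →
      ¬ (α ∈ map (i ,_) (allFin (lookup (parts μ) i)) × α ∈ map (i′ ,_) (allFin (lookup (parts μ) i′)))
    disjoint i≢i′ (p , q) with _ , _ , refl ← ∈-map⁻ _ p | _ , _ , refl ← ∈-map⁻ _ q = i≢i′ refl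

  extendByZero : (Node μ → ℕ) → Box → ℕ
  extendByZero f u with box? u
  ... | yes (α , _) = f α
  ... | no _        = 0

  extendByZero-box : ∀ f α → extendByZero f (box α) ≡ f α
  extendByZero-box f α with box? (box α)
  ... | yes (β , e) = cong f (box-injective e)
  ... | no ¬p       = contradiction (α , refl) ¬p

  -- Going from `α` down its column and then along the row of `β`, the turning point `(i′ , j)` is a
  -- node because `j ≤ j′`.
  standard-mono : ∀ {Q} → IsStandard μ Q → ∀ {α β} → box α ⊑ box β → α ≢ β → Q α Fin.< Q β
  standard-mono {Q} (_ , row , col) {i , j} {i′ , j′} (i≤ , j≤) α≢β with ℕ.m≤n⇒m<n∨m≡n i≤
  ... | inj₂ e with refl ← Fin.toℕ-injective e =
    row i j j′ (ℕ.≤∧≢⇒< j≤ λ e → α≢β (cong (i ,_) (Fin.toℕ-injective e)))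
  standard-mono {Q} (_ , row , col) {i , j} {i′ , j′} (i≤ , j≤) α≢β | inj₁ i< =
    ℕ.<-≤-trans (col i i′ j k i< (sym k≡j)) (in-row (ℕ.m≤n⇒m<n∨m≡n (subst (_≤ toℕ j′) (sym k≡j) j≤)))
    where
    j<′ : toℕ j < lookup (parts μ) i′
    j<′ = ℕ.≤-<-trans j≤ (Fin.toℕ<n j′)
    k = fromℕ< j<′
    k≡j : toℕ k ≡ toℕ j
    k≡j = Fin.toℕ-fromℕ< j<′
    in-row : toℕ k < toℕ j′ ⊎ toℕ k ≡ toℕ j′ → Q (i′ , k) Fin.≤ Q (i′ , j′)
    in-row (inj₁ lt) = ℕ.<⇒≤ (row i′ k j′ lt)
    in-row (inj₂ e)  = ℕ.≤-reflexive (cong (λ k → toℕ (Q (i′ , k))) (Fin.toℕ-injective e))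

  module Standard {Q : Filling μ} (std : IsStandard μ Q) where

    Q-injective : Injective _≡_ _≡_ Q
    Q-injective = proj₁ (proj₁ std)

    node : Fin n → Node μ
    node k = proj₁ (proj₂ (proj₁ std) k)

    Q-node : ∀ k → Q (node k) ≡ k
    Q-node k = proj₂ (proj₂ (proj₁ std) k) refl

    node-Q : ∀ α → node (Q α) ≡ α
    node-Q α = Q-injective (Q-node (Q α))

    -- Pedestals are controlled only from one entry to the next. This spreads such local comparisons
    -- over the whole order of `Q`.
    consecutive-induction : (R : Node μ → Node μ → Set) → (∀ {α β γ} → R α β → R β γ → R α γ) →
      (∀ {α β} → toℕ (Q β) ≡ suc (toℕ (Q α)) → R α β) → ∀ {α β} → Q α Fin.< Q β → R α β
    consecutive-induction R R-trans next {α} {β} lt = go (toℕ (Q β)) refl lt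
      where
      go : ∀ k {β} → toℕ (Q β) ≡ k → toℕ (Q α) < k → R α β
      go (suc k) {β} e (s≤s le) with ℕ.m≤n⇒m<n∨m≡n le
      ... | inj₂ refl = next e
      ... | inj₁ lt   = R-trans (go k γ≡k lt) (next (trans e (cong suc (sym γ≡k))))
        where
        k<n : k < n
        k<n = ℕ.<⇒≤ (subst (_< n) e (Fin.toℕ<n (Q β)))
        γ≡k : toℕ (Q (node (fromℕ< k<n))) ≡ k
        γ≡k = trans (cong toℕ (Q-node _)) (Fin.toℕ-fromℕ< k<n)

    Q-nodes-↭ : map Q (nodes μ) ↭ allFin n
    Q-nodes-↭ = unique-↭ (Unique.map⁺ Q-injective nodes-unique) (Unique.allFin⁺ n)
      (λ {k} → mk⇔ (λ _ → ∈-allFin k)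
        λ _ → subst (_∈ map Q (nodes μ)) (Q-node k) (∈-map⁺ Q (nodes-complete μ (node k))))

    nodes-length : length (nodes μ) ≡ n
    nodes-length = trans (sym (List.length-map Q (nodes μ)))
      (trans (↭.↭-length Q-nodes-↭) (List.length-tabulate id))

    rank-Q : ∀ α → count μ (λ β → Q β Fin.<? Q α) ≡ toℕ (Q α)
    rank-Q α = go (toℕ (Q α)) refl
      where
      go : ∀ k {α} → toℕ (Q α) ≡ k → count μ (λ β → Q β Fin.<? Q α) ≡ k
      go zero    {α} e = cong length (List.filter-none (λ β → Q β Fin.<? Q α)
        (All.universal (λ β lt → ℕ.n≮0 (subst (toℕ (Q β) <_) e lt)) (nodes μ)))
      go (suc k) {α} e = trans
        (length-filter-suc (λ β → Q β Fin.<? Q α) (λ β → Q β Fin.<? Q γ) nodes-unique (nodes-complete μ γ)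
          γ<α (ℕ.<-irrefl refl) λ {β} β≢γ → mk⇔
            (λ lt → ℕ.≤∧≢⇒< (ℕ.≤-pred (subst (suc (toℕ (Q β)) ≤_) α≡ lt))
              λ e → β≢γ (Q-injective (Fin.toℕ-injective e)))
            (λ lt → ℕ.<-trans lt γ<α))
        (cong suc (go k γ≡k))
        where
        k<n : k < n
        k<n = ℕ.<⇒≤ (subst (_< n) e (Fin.toℕ<n (Q α)))
        γ = node (fromℕ< k<n)
        γ≡k : toℕ (Q γ) ≡ k
        γ≡k = trans (cong toℕ (Q-node _)) (Fin.toℕ-fromℕ< k<n)
        α≡ : toℕ (Q α) ≡ suc (toℕ (Q γ))
        α≡ = trans e (cong suc (sym γ≡k))
        γ<α : Q γ Fin.< Q α
        γ<α = ℕ.≤-reflexive (sym α≡)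

-- Order preserving maps and the hook product

module _ {n} (μ : Partition n) where

  OrderPreserving : (Node μ → ℕ) → Set
  OrderPreserving f = ∀ {α β} → box μ α ⊑ box μ β → f α ≤ f β

  OrderPreservingMaps : Graded
  OrderPreservingMaps = record
    { setoid      = Node μ →-setoid ℕ
    ; Valid       = OrderPreserving
    ; weight      = λ f → sum (map f (nodes μ))
    ; weight-cong = λ f≗g → sum-map-cong (nodes μ) λ {α} _ → f≗g α
    }

  module _ {P : Filling μ} (std : IsStandard μ P) where

    open Standard μ std renaming
      (Q-injective to P-injective; Q-node to P-node; node-Q to node-P; nodes-length to size)

    -- `P` prescribes the growth: these are the boxes with entries below `k`, the largest entry at
    -- the head. As `P` increases along rows and columns, each head is addable to its tail.
    below : ∀ k → k ≤ n → List Box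
    below zero    _   = []
    below (suc k) k<n = box μ (node (fromℕ< k<n)) ∷ below k (ℕ.<⇒≤ k<n)

    below⁺ : ∀ k (k≤n : k ≤ n) {α} → toℕ (P α) < k → box μ α ∈ below k k≤n
    below⁺ (suc k) k<n {α} (s≤s le) with ℕ.m≤n⇒m<n∨m≡n le
    ... | inj₁ lt = there (below⁺ k _ lt)
    ... | inj₂ refl = here (cong (box μ) (trans (sym (node-P α)) (cong node (sym (Fin.fromℕ<-toℕ (P α) k<n)))))

    below⁻ : ∀ k (k≤n : k ≤ n) {u} → u ∈ below k k≤n → ∃[ α ] box μ α ≡ u × toℕ (P α) < k
    below⁻ (suc k) k<n (here refl) =
      _ , refl , s≤s (ℕ.≤-reflexive (trans (cong toℕ (P-node _)) (Fin.toℕ-fromℕ< k<n)))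
    below⁻ (suc k) k<n (there u∈) with α , e , lt ← below⁻ k _ u∈ = α , e , ℕ.m≤n⇒m≤1+n lt

    below-diagram : ∀ k k≤n → Diagram (below k k≤n)
    below-diagram zero    _   = []
    below-diagram (suc k) k<n = (fresh , closed) ∷ below-diagram k _
      where
      c = node (fromℕ< k<n)
      Pc≡k : toℕ (P c) ≡ k
      Pc≡k = trans (cong toℕ (P-node _)) (Fin.toℕ-fromℕ< k<n)
      fresh : box μ c ∉ below k (ℕ.<⇒≤ k<n)
      fresh c∈ with α , e , lt ← below⁻ k _ c∈ =
        ℕ.<-irrefl (trans (cong (toℕ ∘ P) (box-injective μ e)) Pc≡k) lt
      closed : ∀ {u} → u ⊑ box μ c → u ≢ box μ c → u ∈ below k (ℕ.<⇒≤ k<n)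
      closed u⊑c u≢c with α , refl ← box-closed μ c u⊑c = below⁺ k _
        (subst (toℕ (P α) <_) Pc≡k (standard-mono μ std u⊑c (u≢c ∘ cong (box μ))))

    diagram : List Box
    diagram = below n ℕ.≤-refl

    diagram-isDiagram : Diagram diagram
    diagram-isDiagram = below-diagram n ℕ.≤-refl

    box∈diagram : ∀ α → box μ α ∈ diagram
    box∈diagram α = below⁺ n ℕ.≤-refl (Fin.toℕ<n (P α))

    diagram-unique : ∀ {L} → Diagram L → Unique L
    diagram-unique []              = []
    diagram-unique ((c∉L , _) ∷ D) = All.tabulate (λ { u∈L refl → c∉L u∈L }) ∷ diagram-unique D

    boxes : List Box
    boxes = map (box μ) (nodes μ)

    boxes-unique : Unique boxes
    boxes-unique = Unique.map⁺ (box-injective μ) (nodes-unique μ)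

    diagram⇔boxes : ∀ {u} → u ∈ diagram ⇔ u ∈ boxes
    diagram⇔boxes = mk⇔
      (λ u∈ → let α , e , _ = below⁻ n ℕ.≤-refl u∈ in subst (_∈ boxes) e (∈-map⁺ (box μ) (nodes-complete μ α)))
      (λ u∈ → let α , _ , e = ∈-map⁻ (box μ) u∈ in subst (_∈ diagram) (sym e) (box∈diagram α))

    diagram↭boxes : diagram ↭ boxes
    diagram↭boxes = unique-↭ (diagram-unique diagram-isDiagram) boxes-unique diagram⇔boxes

    sum-boxes : ∀ (f : Box → ℕ) → sum (map f boxes) ≡ sum (map f diagram)
    sum-boxes f = sym (sum-map-↭ f diagram↭boxes)

    hook≡hookLength : ∀ α → hook diagram (box μ α) ≡ hookLength μ α
    hook≡hookLength α = trans (↭.↭-length (↭.filter-↭ (hookBox? (box μ α)) diagram↭boxes))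
      (length-filter-map (hookBox? (box μ α)) (inHook? μ α) (λ _ → mk⇔ id id) (nodes μ))

    hookProduct≡ : ∏𝟙⊖x^ (hook diagram) boxes ≡ hookProduct μ
    hookProduct≡ = cong ∏ (trans (sym (List.map-∘ (nodes μ)))
      (List.map-cong (λ α → cong (λ h → 𝟙 ⊖ x^ h) (hook≡hookLength α)) (nodes μ)))

    Trivial : Graded
    Trivial = record { setoid = ≡.setoid ⊤ ; Valid = λ _ → ⊤ ; weight = λ _ → 0 ; weight-cong = λ _ → refl }

    trivial-hasSeries : Trivial HasSeries 𝟙
    trivial-hasSeries zero = record
      { elements = tt ∷ [] ; sound = (tt , refl) ∷ [] ; distinct = [] ∷ [] ; complete = λ _ → here refl } , refl
    trivial-hasSeries (suc m) = record
      { elements = [] ; sound = [] ; distinct = [] ; complete = λ () } , refl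

    hook-multisets≅ : Multisets (hook diagram) boxes Trivial ≅ OrderPreservingMaps
    hook-multisets≅ = record
      { forward          = λ (A , _) → fromMultiplicities diagram A ∘ box μ
      ; preserves-≈ = λ (A≈B , _) α → fromMultiplicities-cong D (A≈B ∘ to diagram⇔boxes) (box∈diagram α)
      ; valid       = λ { {A , _} _ {α} {β} α⊑β → rpp-mono (fromMultiplicities-rpp D A) D α⊑β (box∈diagram β) }
      ; weighted    = λ { {A , _} _ → weighted A }
      ; injective   = λ { {A , _} {B , _} _ _ e → (λ {u} u∈ → trans (sym (to∘from D A (from diagram⇔boxes u∈)))
          (trans (toMultiplicities-cong D (agree e) (from diagram⇔boxes u∈))
          (to∘from D B (from diagram⇔boxes u∈)))) , refl }
      -- The toggles act on functions of all boxes. Values outside the diagram do not influence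
      -- those inside, so extending `f` by zero is an arbitrary choice.
      ; surjective  = λ {f} mono → (toMultiplicities diagram (extendByZero μ f) , tt) , tt ,
          λ α → trans (from∘to D (rpp {f} mono) (box∈diagram α)) (extendByZero-box μ f α)
      }
      where
      D = diagram-isDiagram
      open ≡-Reasoning
      weighted : ∀ A → sum (map (fromMultiplicities diagram A ∘ box μ) (nodes μ)) ≡
        total-weight (hook diagram) boxes A + 0
      weighted A = begin
        sum (map (fromMultiplicities diagram A ∘ box μ) (nodes μ)) ≡⟨ cong sum (List.map-∘ (nodes μ)) ⟩
        sum (map (fromMultiplicities diagram A) boxes)             ≡⟨ sum-boxes (fromMultiplicities diagram A) ⟩
        sum (map (fromMultiplicities diagram A) diagram)           ≡⟨ fromMultiplicities-sum D A ⟩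
        sum (map (λ u → hook diagram u * A u) diagram)             ≡⟨ sum-boxes (λ u → hook diagram u * A u) ⟨
        total-weight (hook diagram) boxes A                        ≡⟨ ℕ.+-identityʳ _ ⟨
        total-weight (hook diagram) boxes A + 0                    ∎
      agree : ∀ {π ρ : Box → ℕ} → π ∘ box μ ≗ ρ ∘ box μ → π ≈⟨ diagram ⟩ ρ
      agree e u∈ with α , refl , _ ← below⁻ n ℕ.≤-refl u∈ = e α
      extension-mono : ∀ {f} → OrderPreserving f → ∀ {u v} → u ⊑ v → v ∈ diagram →
        extendByZero μ f u ≤ extendByZero μ f v
      extension-mono {f} mono u⊑v v∈ with β , refl , _ ← below⁻ n ℕ.≤-refl v∈ with α , refl ← box-closed μ β u⊑v =
        subst₂ _≤_ (sym (extendByZero-box μ f α)) (sym (extendByZero-box μ f β)) (mono u⊑v)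
      rpp : ∀ {f} → OrderPreserving f → ReversePlanePartition diagram (extendByZero μ f)
      rpp mono = lower-rpp (λ {i} u∈ → extension-mono mono (ℕ.n≤1+n i , ℕ.≤-refl) u∈)
        (λ {i} {j} u∈ → extension-mono mono (ℕ.≤-refl , ℕ.n≤1+n j) u∈)

    hookSeries : OrderPreservingMaps HasSeries (hookProduct μ) ⁻¹
    hookSeries = _≅_.hasSeries hook-multisets≅
      (multisets-hasSeries _≟ᵇ_ (hook diagram) boxes-unique
        (All.map⁺ (All.universal (λ α → subst (1 ≤_) (sym (hook≡hookLength α)) (hookLength-positive μ α)) (nodes μ)))
        trivial-hasSeries
        (subst (λ p → p ⊛ (hookProduct μ) ⁻¹ ≗ 𝟙) (sym hookProduct≡)
          (⁻¹-inverseʳ (hookProduct μ) (hookProduct-constant μ))))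

-- Pedestals and the generating function of tableaux

monomials-coefficient : ∀ {A : Set} (w : A → ℕ) as m →
  ⨁ (map (λ a → x^ w a) as) m ≡ ℤ.+ length (filter (λ a → w a ℕ.≟ m) as)
monomials-coefficient w []       m = refl
monomials-coefficient w (a ∷ as) m = go (w a ℕ.≟ m)
  where
  x^-≡ : ∀ k → (x^ k) k ≡ 1ℤ
  x^-≡ zero    = refl
  x^-≡ (suc k) = x^-≡ k
  x^-≢ : ∀ k m → k ≢ m → (x^ k) m ≡ 0ℤ
  x^-≢ zero    zero    k≢m = contradiction refl k≢m
  x^-≢ zero    (suc m) k≢m = refl
  x^-≢ (suc k) zero    k≢m = refl
  x^-≢ (suc k) (suc m) k≢m = x^-≢ k m (k≢m ∘ cong suc)
  go : Dec (w a ≡ m) →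
    (x^ w a) m ℤ.+ ⨁ (map (λ a → x^ w a) as) m ≡ ℤ.+ length (filter (λ a → w a ℕ.≟ m) (a ∷ as))
  go (yes refl) = trans (cong₂ ℤ._+_ (x^-≡ m) (monomials-coefficient w as m))
    (cong (ℤ.+_ ∘ length) (sym (List.filter-accept (λ a → w a ℕ.≟ m) {xs = as} refl)))
  go (no w≢m)   = trans (cong₂ ℤ._+_ (x^-≢ (w a) m w≢m) (monomials-coefficient w as m))
    (cong (ℤ.+_ ∘ length) (sym (List.filter-reject (λ a → w a ℕ.≟ m) {xs = as} w≢m)))

module _ {n} (μ : Partition n) {P : Filling μ} (P-std : IsStandard μ P) where

  private
    P-injective : Injective _≡_ _≡_ P
    P-injective = proj₁ (proj₁ P-std)

  Disagreement-cong : ∀ {Q R : Filling μ} → Q ≗ R → ∀ {α} → Disagreement μ P Q α → Disagreement μ P R α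
  Disagreement-cong Q≗R {α} (β , e , lt) =
    β , trans (cong toℕ (sym (Q≗R β))) (trans e (cong (suc ∘ toℕ) (Q≗R α))) , lt

  pedestal-cong : ∀ {Q R : Filling μ} → Q ≗ R → pedestal μ P Q ≗ pedestal μ P R
  pedestal-cong {Q} {R} Q≗R α = length-filter-cong
    (λ β → (Q β Fin.<? Q α) ×-dec disagreement? μ P Q β) (λ β → (R β Fin.<? R α) ×-dec disagreement? μ P R β)
    (nodes μ) λ {β} _ → mk⇔
      (λ (lt , d) → subst₂ Fin._<_ (Q≗R β) (Q≗R α) lt , Disagreement-cong Q≗R d)
      (λ (lt , d) → subst₂ Fin._<_ (sym (Q≗R β)) (sym (Q≗R α)) lt , Disagreement-cong (sym ∘ Q≗R) d)

  Tableaux : Graded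
  Tableaux = record
    { setoid      = Node μ →-setoid Fin n
    ; Valid       = IsStandard μ
    ; weight      = ∣pedestal∣ μ P
    ; weight-cong = λ Q≗R → sum-map-cong (nodes μ) λ {α} _ → pedestal-cong Q≗R α
    }

  tableaux-hasSeries : Tableaux HasSeries π μ P
  tableaux-hasSeries m = record
    { elements = filter weight? (𝔰𝔱 μ)
    ; sound    = All.zip (All.filter⁺ weight? (𝔰𝔱-standard μ) , All.all-filter weight? (𝔰𝔱 μ))
    ; distinct = AllPairs.filter⁺ weight? (𝔰𝔱-unique μ)
    ; complete = λ {Q} (std , e) → any-filter weight?
        (λ Q≗R → trans (sym (Graded.weight-cong Tableaux Q≗R)) e) (𝔰𝔱-complete μ Q std)
    } , monomials-coefficient (∣pedestal∣ μ P) (𝔰𝔱 μ) m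
    where
    weight? : Decidable (λ Q → ∣pedestal∣ μ P Q ≡ m)
    weight? Q = ∣pedestal∣ μ P Q ℕ.≟ m

  module Lex (f : Node μ → ℕ) where

    infix 4 _◁_ _◁?_
    _◁_ : Node μ → Node μ → Set
    α ◁ β = f α < f β ⊎ (f α ≡ f β × P α Fin.< P β)

    _◁?_ : ∀ α β → Dec (α ◁ β)
    α ◁? β = (f α ℕ.<? f β) ⊎-dec ((f α ℕ.≟ f β) ×-dec (P α Fin.<? P β))

    ◁-irrefl : ∀ {α} → ¬ α ◁ α
    ◁-irrefl (inj₁ lt)       = ℕ.<-irrefl refl lt
    ◁-irrefl (inj₂ (_ , lt)) = ℕ.<-irrefl refl lt

    ◁-trans : ∀ {α β γ} → α ◁ β → β ◁ γ → α ◁ γ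
    ◁-trans (inj₁ p)       (inj₁ q)        = inj₁ (ℕ.<-trans p q)
    ◁-trans {α} (inj₁ p)   (inj₂ (e , _))  = inj₁ (subst (f α <_) e p)
    ◁-trans {γ = γ} (inj₂ (e , _)) (inj₁ q) = inj₁ (subst (_< f γ) (sym e) q)
    ◁-trans (inj₂ (e , p)) (inj₂ (e′ , q)) = inj₂ (trans e e′ , ℕ.<-trans p q)

    ◁-connected : ∀ {α β} → α ≢ β → α ◁ β ⊎ β ◁ α
    ◁-connected {α} {β} α≢β with ℕ.<-cmp (f α) (f β) | ℕ.<-cmp (toℕ (P α)) (toℕ (P β))
    ... | tri< p _ _ | _ = inj₁ (inj₁ p)
    ... | tri> _ _ p | _ = inj₂ (inj₁ p)
    ... | tri≈ _ e _ | tri< p _ _ = inj₁ (inj₂ (e , p))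
    ... | tri≈ _ e _ | tri> _ _ p = inj₂ (inj₂ (sym e , p))
    ... | tri≈ _ e _ | tri≈ _ p _ = contradiction (P-injective (Fin.toℕ-injective p)) α≢β

    ◁⇒≤ : ∀ {α β} → α ◁ β → f α ≤ f β
    ◁⇒≤ (inj₁ lt)      = ℕ.<⇒≤ lt
    ◁⇒≤ (inj₂ (e , _)) = ℕ.≤-reflexive e

    ◁-reflects : ∀ {Q : Filling μ} → Injective _≡_ _≡_ Q → (∀ {α β} → Q α Fin.< Q β → α ◁ β) →
      ∀ {α β} → α ◁ β → Q α Fin.< Q β
    ◁-reflects {Q} Q-inj Q⇒◁ {α} {β} lt with ℕ.<-cmp (toℕ (Q α)) (toℕ (Q β))
    ... | tri< p _ _ = p
    ... | tri≈ _ e _ with refl ← Q-inj (Fin.toℕ-injective e) = contradiction lt ◁-irrefl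
    ... | tri> _ _ p = contradiction (◁-trans lt (Q⇒◁ p)) ◁-irrefl

    -- An entry is the number of nodes with smaller entries, and for a tableau compatible with the
    -- linear order `◁` this number depends on `◁` alone.
    compatible-unique : ∀ {Q R : Filling μ} → IsStandard μ Q → IsStandard μ R →
      (∀ {α β} → Q α Fin.< Q β → α ◁ β) → (∀ {α β} → R α Fin.< R β → α ◁ β) → Q ≗ R
    compatible-unique {Q} {R} Q-std R-std Q⇒◁ R⇒◁ α = Fin.toℕ-injective (begin
      toℕ (Q α)                          ≡⟨ Standard.rank-Q μ Q-std α ⟨
      count μ (λ β → Q β Fin.<? Q α)     ≡⟨ length-filter-cong (λ β → Q β Fin.<? Q α) (λ β → R β Fin.<? R α) (nodes μ)
                                              (λ _ → mk⇔ (◁-reflects (proj₁ (proj₁ R-std)) R⇒◁ ∘ Q⇒◁)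
                                                         (◁-reflects (proj₁ (proj₁ Q-std)) Q⇒◁ ∘ R⇒◁)) ⟩
      count μ (λ β → R β Fin.<? R α)     ≡⟨ Standard.rank-Q μ R-std α ⟩
      toℕ (R α)                          ∎)
      where open ≡-Reasoning

    rank : Node μ → ℕ
    rank α = count μ (_◁? α)

    rank-< : ∀ α → rank α < n
    -- There are exactly `n` nodes because `P` is a bijection, and `α` is not counted in its own
    -- rank.
    rank-< α = subst (rank α <_) (Standard.nodes-length μ P-std)
      (List.filter-notAll (_◁? α) (nodes μ) (Any.map (λ { refl → ◁-irrefl }) (nodes-complete μ α)))

    rank-mono : ∀ {α β} → α ◁ β → rank α < rank β
    rank-mono {α} {β} α◁β = length-filter-< (_◁? α) (_◁? β) (nodes-complete μ α) ◁-irrefl α◁β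
      (λ γ◁α → ◁-trans γ◁α α◁β)

    sorted : Filling μ
    sorted α = fromℕ< (rank-< α)

    sorted-mono : ∀ {α β} → α ◁ β → sorted α Fin.< sorted β
    sorted-mono {α} {β} α◁β = subst₂ _<_
      (sym (Fin.toℕ-fromℕ< (rank-< α))) (sym (Fin.toℕ-fromℕ< (rank-< β))) (rank-mono α◁β)

    sorted-injective : Injective _≡_ _≡_ sorted
    sorted-injective {α} {β} e with Fin._≟_ (P α) (P β)
    ... | yes p = P-injective p
    ... | no ¬p with ◁-connected (¬p ∘ cong P)
    ...   | inj₁ lt = contradiction (sorted-mono lt) (ℕ.<-irrefl (cong toℕ e))
    ...   | inj₂ lt = contradiction (sorted-mono lt) (ℕ.<-irrefl (cong toℕ (sym e)))

    sorted-reflects : ∀ {α β} → sorted α Fin.< sorted β → α ◁ β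
    sorted-reflects {α} {β} lt with ◁-connected {α} {β} (λ { refl → ℕ.<-irrefl refl lt })
    ... | inj₁ α◁β = α◁β
    ... | inj₂ β◁α = contradiction (sorted-mono β◁α) (ℕ.<-asym lt)

    -- A tie between comparable nodes is broken by `P`, which, being standard, respects the order of
    -- the diagram. This is what makes `sorted` standard.
    mono⇒◁ : OrderPreserving μ f → ∀ {α β} → box μ α ⊑ box μ β → α ≢ β → α ◁ β
    mono⇒◁ mono α⊑β α≢β with ℕ.m≤n⇒m<n∨m≡n (mono α⊑β)
    ... | inj₁ lt = inj₁ lt
    ... | inj₂ e  = inj₂ (e , standard-mono μ P-std α⊑β α≢β)

    sorted-standard : OrderPreserving μ f → IsStandard μ sorted
    sorted-standard mono =
      ( sorted-injective
      , strictlySurjective⇒surjective λ k → let i , e = injective⇒strictlySurjective sorted-node-injective k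
          in S.node i , e ) ,
      (λ i j j′ lt → sorted-mono (mono⇒◁ mono (ℕ.≤-refl , ℕ.<⇒≤ lt) λ { refl → ℕ.<-irrefl refl lt })) ,
      (λ i i′ j j′ lt e → sorted-mono (mono⇒◁ mono (ℕ.<⇒≤ lt , ℕ.≤-reflexive e) λ { refl → ℕ.<-irrefl refl lt }))
      where
      module S = Standard μ P-std
      sorted-node-injective : Injective _≡_ _≡_ (sorted ∘ S.node)
      sorted-node-injective {i} {j} e = trans (sym (S.Q-node i)) (trans (cong P (sorted-injective e)) (S.Q-node j))

  module _ {Q : Filling μ} (Q-std : IsStandard μ Q) where

    open Standard μ Q-std

    private
      step? : ∀ α → Decidable (λ β → Q β Fin.< Q α × Disagreement μ P Q β)
      step? α β = (Q β Fin.<? Q α) ×-dec disagreement? μ P Q β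

      <-suc : ∀ {α β γ} → toℕ (Q β) ≡ suc (toℕ (Q α)) → γ ≢ α → Q γ Fin.< Q β → Q γ Fin.< Q α
      <-suc {γ = γ} e γ≢α lt = ℕ.≤∧≢⇒< (ℕ.≤-pred (subst (toℕ (Q γ) <_) e lt))
        λ e → γ≢α (Q-injective (Fin.toℕ-injective e))

    -- From `α` to its successor `β` the only new candidate in the count is `α` itself, and it
    -- counts precisely when `P β` is less than `P α`.
    pedestal-descent : ∀ {α β} → toℕ (Q β) ≡ suc (toℕ (Q α)) → P β Fin.< P α →
      pedestal μ P Q β ≡ suc (pedestal μ P Q α)
    pedestal-descent {α} {β} e lt = length-filter-suc (step? β) (step? α) (nodes-unique μ) (nodes-complete μ α)
      (α<β , β , e , lt) (λ (p , _) → ℕ.<-irrefl refl p)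
      λ γ≢α → mk⇔ (λ (p , d) → <-suc e γ≢α p , d) (λ (p , d) → ℕ.<-trans p α<β , d)
      where
      α<β : Q α Fin.< Q β
      α<β = ℕ.≤-reflexive (sym e)

    pedestal-ascent : ∀ {α β} → toℕ (Q β) ≡ suc (toℕ (Q α)) → P α Fin.< P β →
      pedestal μ P Q β ≡ pedestal μ P Q α
    pedestal-ascent {α} {β} e lt = length-filter-cong (step? β) (step? α) (nodes μ) λ {γ} _ → mk⇔
      (λ (p , d) → <-suc e (λ { refl → agreement d }) p , d)
      (λ (p , d) → ℕ.<-trans p (ℕ.≤-reflexive (sym e)) , d)
      where
      agreement : ¬ Disagreement μ P Q α
      agreement (β′ , e′ , lt′) with refl ← Q-injective {β′} {β} (Fin.toℕ-injective (trans e′ (sym e))) =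
        ℕ.<-asym lt lt′

    consecutive : ∀ {α β} → toℕ (Q β) ≡ suc (toℕ (Q α)) → P α Fin.< P β ⊎ P β Fin.< P α
    consecutive {α} {β} e with ℕ.<-cmp (toℕ (P α)) (toℕ (P β))
    ... | tri< p _ _ = inj₁ p
    ... | tri> _ _ p = inj₂ p
    ... | tri≈ _ p _ with refl ← P-injective (Fin.toℕ-injective p) = contradiction (sym e) ℕ.1+n≢n

    pedestal-first : ∀ {α} → toℕ (Q α) ≡ 0 → pedestal μ P Q α ≡ 0
    pedestal-first {α} e = cong length (List.filter-none (step? α)
      (All.universal (λ β (lt , _) → ℕ.n≮0 (subst (toℕ (Q β) <_) e lt)) (nodes μ)))

  onPedestal : (ℕ → ℕ) → Filling μ → Node μ → ℕ
  onPedestal d Q α = pedestal μ P Q α + fromSteps n d (toℕ (Q α))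

  -- At a disagreement node the pedestal jumps, so the value rises strictly. At any other step the
  -- value may stay equal, but then `P` agrees with `Q` and breaks the tie the right way.
  onPedestal-◁ : ∀ {Q : Filling μ} → IsStandard μ Q → ∀ d {α β} → Q α Fin.< Q β → Lex._◁_ (onPedestal d Q) α β
  onPedestal-◁ {Q} Q-std d = consecutive-induction _◁_ ◁-trans next
    where
    open Standard μ Q-std
    open Lex (onPedestal d Q)
    steps-≤ : ∀ {α β} → toℕ (Q β) ≡ suc (toℕ (Q α)) → fromSteps n d (toℕ (Q α)) ≤ fromSteps n d (toℕ (Q β))
    steps-≤ {α} {β} e = subst (λ k → fromSteps n d (toℕ (Q α)) ≤ fromSteps n d k) (sym e)
      (fromSteps-step n d (toℕ (Q α)) (subst (_< n) e (Fin.toℕ<n (Q β))))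
    next : ∀ {α β} → toℕ (Q β) ≡ suc (toℕ (Q α)) → α ◁ β
    next {α} {β} e with consecutive Q-std {α} {β} e
    ... | inj₂ lt = inj₁ (ℕ.+-mono-<-≤ (ℕ.≤-reflexive (sym (pedestal-descent Q-std e lt))) (steps-≤ e))
    ... | inj₁ lt with ℕ.m≤n⇒m<n∨m≡n
      (ℕ.+-mono-≤ (ℕ.≤-reflexive (sym (pedestal-ascent Q-std e lt))) (steps-≤ {α} {β} e))
    ...   | inj₁ p = inj₁ p
    ...   | inj₂ p = inj₂ (p , lt)

  compatible⇒onPedestal : ∀ {f} {Q : Filling μ} → IsStandard μ Q →
    (∀ {α β} → Q α Fin.< Q β → Lex._◁_ f α β) → ∃[ d ] onPedestal d Q ≗ f
  compatible⇒onPedestal {f} {Q} Q-std Q⇒◁ =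
    let d , p = fromSteps-surjective n (excess ∘ node) excess-mono in d , λ α → begin
      ped α + fromSteps n d (toℕ (Q α))  ≡⟨ cong (ped α +_) (p (Q α)) ⟩
      ped α + excess (node (Q α))        ≡⟨ cong (λ β → ped α + excess β) (node-Q α) ⟩
      ped α + (f α ∸ ped α)              ≡⟨ ℕ.m+[n∸m]≡n (pedestal-≤ α) ⟩
      f α                                ∎
    where
    open Lex f
    open Standard μ Q-std
    open ≡-Reasoning
    ped : Node μ → ℕ
    ped = pedestal μ P Q
    excess : Node μ → ℕ
    excess α = f α ∸ ped α
    -- Weak increase of `f - ped` with the subtracted terms moved across, since `ped ≤ f` is itself
    -- derived from this relation.
    R : Node μ → Node μ → Set
    R α β = f α + ped β ≤ f β + ped α
    R-trans : ∀ {α β γ} → R α β → R β γ → R α γ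
    R-trans {α} {β} {γ} p q = ℕ.+-cancelʳ-≤ (f β + ped β) _ _
      (subst₂ _≤_ (r₁ (f α) (ped β) (f β) (ped γ)) (r₂ (f β) (ped α) (f γ) (ped β)) (ℕ.+-mono-≤ p q))
      where
      r₁ : ∀ a b c d → a + b + (c + d) ≡ a + d + (c + b)
      r₁ = solve-∀
      r₂ : ∀ a b c d → a + b + (c + d) ≡ c + b + (a + d)
      r₂ = solve-∀
    next : ∀ {α β} → toℕ (Q β) ≡ suc (toℕ (Q α)) → R α β
    next {α} {β} e with consecutive Q-std {α} {β} e | Q⇒◁ {α} {β} (ℕ.≤-reflexive (sym e))
    ... | inj₁ lt | α◁β = ℕ.+-mono-≤ (◁⇒≤ α◁β) (ℕ.≤-reflexive (pedestal-ascent Q-std e lt))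
    ... | inj₂ lt | inj₁ f< = subst (_≤ f β + ped α)
      (trans (sym (ℕ.+-suc (f α) (ped α))) (cong (f α +_) (sym (pedestal-descent Q-std e lt))))
      (ℕ.+-monoˡ-≤ (ped α) f<)
    -- A tie at a disagreement node would contradict the tie-breaking by `P`. So `f` rises there by
    -- at least one, which is what the pedestal gains.
    ... | inj₂ lt | inj₂ (_ , lt′) = contradiction lt (ℕ.<-asym lt′)
    R-all : ∀ {α β} → Q α Fin.< Q β → R α β
    R-all = consecutive-induction R (λ {α} → R-trans {α}) next
    -- Compared with the node of least entry, where the pedestal vanishes, `R` reads
    -- `f first + ped α ≤ f α`.
    pedestal-≤ : ∀ α → ped α ≤ f α
    pedestal-≤ α = go (toℕ (Q α)) refl
      where
      go : ∀ k → toℕ (Q α) ≡ k → ped α ≤ f α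
      go zero    e = subst (_≤ f α) (sym (pedestal-first Q-std e)) z≤n
      go (suc k) e = ℕ.m+n≤o⇒n≤o (f first) (subst (f first + ped α ≤_)
        (trans (cong (f α +_) (pedestal-first Q-std first≡0)) (ℕ.+-identityʳ (f α)))
        (R-all {first} {α} (subst₂ _<_ (sym first≡0) (sym e) (s≤s z≤n))))
        where
        0<n : 0 < n
        0<n = ℕ.≤-<-trans z≤n (Fin.toℕ<n (Q α))
        first = node (fromℕ< 0<n)
        first≡0 : toℕ (Q first) ≡ 0
        first≡0 = trans (cong toℕ (Q-node _)) (Fin.toℕ-fromℕ< 0<n)
    excess-mono : ∀ {i j} → i Fin.≤ j → excess (node i) ≤ excess (node j)
    excess-mono {i} {j} i≤j with ℕ.m≤n⇒m<n∨m≡n i≤j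
    ... | inj₂ e  = ℕ.≤-reflexive (cong (excess ∘ node) (Fin.toℕ-injective e))
    ... | inj₁ lt = ℕ.m+n≤o⇒m≤o∸n (excess α) (subst₂ _≤_
      (ℕ.+-∸-comm (ped β) (pedestal-≤ α)) (ℕ.m+n∸n≡m (f β) (ped α))
      (ℕ.∸-monoˡ-≤ (ped α) (R-all {α} {β} (subst₂ Fin._<_ (sym (Q-node i)) (sym (Q-node j)) lt))))
      where
      α = node i
      β = node j

  pedestal-multisets≅ : Multisets suc (upTo n) Tableaux ≅ OrderPreservingMaps μ
  pedestal-multisets≅ = record
    { forward          = λ (d , Q) → onPedestal d Q
    ; preserves-≈ = λ { {d , Q} {e , R} (d≈e , Q≗R) α → cong₂ _+_ (pedestal-cong Q≗R α)
        (trans (fromSteps-cong n (d≈e ∘ ∈-upTo⁺) (toℕ (Q α))) (cong (fromSteps n e ∘ toℕ) (Q≗R α))) }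
    ; valid       = λ { {d , Q} std {α} {β} → valid d std }
    ; weighted    = λ { {d , Q} std → weighted d std }
    ; injective   = λ { {d , Q} {e , R} Q-std R-std p → injective d e Q-std R-std p }
    ; surjective  = λ {f} mono →
        let d , e = compatible⇒onPedestal (Lex.sorted-standard f mono) (Lex.sorted-reflects f) in
        (d , Lex.sorted f) , Lex.sorted-standard f mono , e
    }
    where
    open ≡-Reasoning
    valid : ∀ d {Q} → IsStandard μ Q → OrderPreserving μ (onPedestal d Q)
    valid d {Q} std {α} {β} α⊑β with Fin._≟_ (Q α) (Q β)
    ... | yes e with refl ← proj₁ (proj₁ std) {α} {β} e = ℕ.≤-refl
    ... | no ¬e = Lex.◁⇒≤ (onPedestal d Q) (onPedestal-◁ std d (standard-mono μ std α⊑β (¬e ∘ cong Q)))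
    weighted : ∀ d {Q} → IsStandard μ Q →
      sum (map (onPedestal d Q) (nodes μ)) ≡ total-weight suc (upTo n) d + ∣pedestal∣ μ P Q
    weighted d {Q} std = begin
      sum (map (onPedestal d Q) (nodes μ))
        ≡⟨ sum-map-+ (pedestal μ P Q) (fromSteps n d ∘ toℕ ∘ Q) (nodes μ) ⟩
      ∣pedestal∣ μ P Q + sum (map (fromSteps n d ∘ toℕ ∘ Q) (nodes μ))
        ≡⟨ cong (λ x → ∣pedestal∣ μ P Q + sum x) (List.map-∘ (nodes μ)) ⟩
      ∣pedestal∣ μ P Q + sum (map (fromSteps n d ∘ toℕ) (map Q (nodes μ)))
        ≡⟨ cong (∣pedestal∣ μ P Q +_) (sum-map-↭ (fromSteps n d ∘ toℕ) (Standard.Q-nodes-↭ μ std)) ⟩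
      ∣pedestal∣ μ P Q + sum (map (fromSteps n d ∘ toℕ) (allFin n))
        ≡⟨ cong (λ x → ∣pedestal∣ μ P Q + sum x) (List.map-tabulate {n = n} id (fromSteps n d ∘ toℕ)) ⟩
      ∣pedestal∣ μ P Q + sum (tabulate {n = n} (fromSteps n d ∘ toℕ))
        ≡⟨ cong (∣pedestal∣ μ P Q +_) (fromSteps-sum n d) ⟩
      ∣pedestal∣ μ P Q + total-weight suc (upTo n) d
        ≡⟨ ℕ.+-comm (∣pedestal∣ μ P Q) _ ⟩
      total-weight suc (upTo n) d + ∣pedestal∣ μ P Q  ∎
    ◁-cong : ∀ {f g} → f ≗ g → ∀ {α β} → Lex._◁_ f α β → Lex._◁_ g α β
    ◁-cong f≗g {α} {β} (inj₁ lt)       = inj₁ (subst₂ _<_ (f≗g α) (f≗g β) lt)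
    ◁-cong f≗g {α} {β} (inj₂ (e , lt)) = inj₂ (trans (sym (f≗g α)) (trans e (f≗g β)) , lt)
    injective : ∀ d e {Q R} → IsStandard μ Q → IsStandard μ R → onPedestal d Q ≗ onPedestal e R →
      (∀ {i} → i ∈ upTo n → d i ≡ e i) × Q ≗ R
    injective d e {Q} {R} Q-std R-std p = (λ i∈ → fromSteps-injective n steps (∈-upTo⁻ i∈)) , Q≗R
      where
      open Standard μ Q-std
      Q≗R : Q ≗ R
      -- By `p`, `R` is compatible with the order of `onPedestal d Q` as well, and such a tableau is
      -- unique. Only then are the pedestals known to coincide, and cancelling them leaves the
      -- steps.
      Q≗R = Lex.compatible-unique (onPedestal d Q) Q-std R-std (onPedestal-◁ Q-std d)
        (◁-cong (sym ∘ p) ∘ onPedestal-◁ R-std e)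
      steps : ∀ k → fromSteps n d (toℕ k) ≡ fromSteps n e (toℕ k)
      steps k = begin
        fromSteps n d (toℕ k)         ≡⟨ cong (fromSteps n d ∘ toℕ) (Q-node k) ⟨
        fromSteps n d (toℕ (Q α))     ≡⟨ ℕ.+-cancelˡ-≡ (pedestal μ P Q α) _ _ (trans (p α)
                                           (cong (_+ fromSteps n e (toℕ (R α))) (sym (pedestal-cong Q≗R α)))) ⟩
        fromSteps n e (toℕ (R α))     ≡⟨ cong (fromSteps n e ∘ toℕ) (Q≗R α) ⟨
        fromSteps n e (toℕ (Q α))     ≡⟨ cong (fromSteps n e ∘ toℕ) (Q-node k) ⟩
        fromSteps n e (toℕ k)         ∎
        where α = node k

  pedestalSeries : OrderPreservingMaps μ HasSeries π μ P ⊛ (qPochhammer n) ⁻¹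
  pedestalSeries = _≅_.hasSeries pedestal-multisets≅
    (multisets-hasSeries ℕ._≟_ suc (Unique.upTo⁺ n) (All.universal (λ _ → s≤s z≤n) (upTo n)) tableaux-hasSeries
      (∏𝟙⊖x^-⨁ suc (upTo n) ((qPochhammer n) ⁻¹) (⁻¹-inverseʳ (qPochhammer n) (qPochhammer-constant n))
        (∣pedestal∣ μ P) (𝔰𝔱 μ)))

mainTheorem3 : ∀ (n : ℕ) → 1 ≤ n → (μ : Partition n) (P : Filling μ) → IsStandard μ P →
    (hookProduct μ) ⁻¹ ≗ π μ P ⊛ (qPochhammer n) ⁻¹
mainTheorem3 n _ μ P std = series-unique (hookSeries μ std) (pedestalSeries μ std)
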